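{- Let $\alpha$ be a countable ordinal and let $\varphi$ be a $\Pi_\alpha$ sentence of $\mathcal{L}_{\omega_1\omega}$ in the language of trees which is satisfiable among trees (i.e. some tree is a model of $\varphi$). Then there is a tree $\mathcal{A}$ with $\mathcal{A} \models \varphi$ such that $\mathcal{A}$ has a $\Pi_{\alpha+3}$ Scott sentence, and hence $\mathcal{A}$ has Scott rank at most $\alpha+2$.
   Context: All structures are countable. A tree is a rooted connected acyclic graph, viewed as a structure in the language $\mathcal{L}_{tree} = \{r, P\}$, where $r$ is a constant for the root and $P$ is the parent relation, holding between each non-root vertex and its parent (the language is formally treated as relational, so $P$ is a binary relation). $\mathcal{L}_{\omega_1\omega}$ is the infinitary logic allowing countable conjunctions and disjunctions. The hierarchy $\Sigma_\alpha/\Pi_\alpha$ of $\mathcal{L}_{\omega_1\omega}$ formulas is the usual one: $\Sigma_0=\Pi_0$ are the finitary quantifier-free formulas; for $\alpha>0$, a $\Sigma_\alpha$ formula is a countable disjunction of formulas $\exists \bar y\,\psi$ with $\psi$ a $\Pi_\beta$ formula for some $\beta<\alpha$, and a $\Pi_\alpha$ formula is a countable conjunction of formulas $\forall \bar y\,\psi$ with $\psi$ a $\Sigma_\beta$ formula for some $\beta<\alpha$. A Scott sentence for a countable structure $\mathcal{A}$ is an $\mathcal{L}_{\omega_1\omega}$ sentence $\theta$ such that for all countable structures $\mathcal{B}$ in the same language, $\mathcal{B}\models\theta$ if and only if $\mathcal{B}\cong\mathcal{A}$. The Scott rank of $\mathcal{A}$ is the least $\alpha$ such that $\mathcal{A}$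 has a $\Pi_{\alpha+1}$ Scott sentence. -}

module Defs where

open import Axiom.ExcludedMiddle using (ExcludedMiddle)
open import Data.Fin.Base using (Fin)
open import Data.List.Base using (List; []; _∷_; length)
open import Data.List.Relation.Unary.Unique.Propositional using (Unique)
open import Data.Maybe.Base using (just; nothing)
open import Data.Nat.Base using (ℕ; zero; suc; _≤_)
open import Data.Nat.Properties using (suc-injective)
open import Data.Product.Base using (Σ-syntax; ∃-syntax; _×_; _,_)
open import Data.Sum.Base using (_⊎_)
open import Data.Vec.Base using (Vec; []; _∷_; lookup)
open import Function.Bundles using (_↣_; _↔_; _⇔_; Injection; Inverse; mk↣)
open import Function.Definitions using (Injective)
open import Induction.WellFounded using (WellFounded; Acc; acc)
open import Level using (0ℓ; Setω)
open import Relation.Binary.Construct.Add.Supremum.Strict using (_<⁺_; [_]; [_]<⊤⁺; <⁺-isStrictTotalOrder-≡)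
open import Relation.Binary.Construct.Closure.ReflexiveTransitive using (Star; ε; _◅_)
open import Relation.Binary.Core using (Rel)
open import Relation.Binary.Definitions using (Irreflexive; Symmetric)
open import Relation.Binary.PropositionalEquality.Core using (_≡_; refl; cong)
open import Relation.Binary.Structures using (IsStrictTotalOrder)
open import Relation.Nullary.Construct.Add.Supremum using (_⁺; ⊤⁺)
open import Relation.Nullary.Negation.Core using (¬_)

-- The ambient logic of classical model theory.  `ExcludedMiddle` ranges over
-- all types, not just over proof-irrelevant ones, so it also yields choice.
Classical : Setω
Classical = ∀ {ℓ} → ExcludedMiddle ℓ

-- Finite sets and the empty set count as countable.
Countable : Set → Set
Countable A = A ↣ ℕ

------------------------------------------------------------------------
-- Countable ordinals

-- An ordinal is presented by a well-order of that order type; presentations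
-- of the same ordinal are isomorphic, not equal.
record Ordinal : Set₁ where
  field
    Elt                : Set
    _<_                : Rel Elt 0ℓ
    isStrictTotalOrder : IsStrictTotalOrder _≡_ _<_
    wellFounded        : WellFounded _<_
    countable          : Countable Elt

open Ordinal using (Elt)

record _≼_ (α β : Ordinal) : Set where
  private
    module α = Ordinal α
    module β = Ordinal β
  field
    embed      : Elt α → Elt β
    mono       : ∀ {x y} → x α.< y → embed x β.< embed y
    downClosed : ∀ {x b} → b β.< embed x → ∃[ a ] embed a ≡ b

-- α is isomorphic to the initial segment { b ∣ b < bound } of β.
record _≺_ (α β : Ordinal) : Set where
  private
    module α = Ordinal α
    module β = Ordinal β
  field
    bound : Elt β
    embed : Elt α → Elt β
    mono  : ∀ {x y} → x α.< y → embed x β.< embed y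
    image : ∀ {b} → b β.< bound ⇔ (∃[ a ] embed a ≡ b)

IsZero IsPositive : Ordinal → Set
IsZero α     = ¬ Elt α
IsPositive α = Elt α

osuc : Ordinal → Ordinal
osuc α = record
  { Elt                = α.Elt ⁺
  ; _<_                = _<⁺_ α._<_
  ; isStrictTotalOrder = <⁺-isStrictTotalOrder-≡ α._<_ α.isStrictTotalOrder
  ; wellFounded        = wf
  ; countable          = mk↣ code-injective
  }
  where
  module α = Ordinal α

  acc-old : ∀ {x} → Acc α._<_ x → Acc (_<⁺_ α._<_) (just x)
  acc-old (acc rs) = acc λ { [ y<x ] → acc-old (rs y<x) }

  wf : WellFounded (_<⁺_ α._<_)
  wf (just x) = acc-old (α.wellFounded x)
  wf nothing  = acc λ { [ x ]<⊤⁺ → acc-old (α.wellFounded x) }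

  code : α.Elt ⁺ → ℕ
  code nothing  = zero
  code (just x) = suc (Injection.to α.countable x)

  code-injective : Injective _≡_ _≡_ code
  code-injective {nothing} {nothing} _ = refl
  code-injective {just x}  {just y}  p =
    cong just (Injection.injective α.countable (suc-injective p))

infixl 6 _+ₒ_

_+ₒ_ : Ordinal → ℕ → Ordinal
α +ₒ zero  = α
α +ₒ suc n = osuc (α +ₒ n)

------------------------------------------------------------------------
-- The logic L_{ω₁ω} in the language {r, P}

-- Formulas with free variables among n de Bruijn variables; a quantifier binds
-- the variable `Fin.zero` of its body.
data Term (n : ℕ) : Set where
  var : Fin n → Term n
  r   : Term n

infix  8 _≐_
infixr 6 _∧̇_
infixr 5 _∨̇_

data Formula (n : ℕ) : Set₁ where
  _≐_  : Term n → Term n → Formula n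
  P    : Term n → Term n → Formula n
  ¬̇_   : Formula n → Formula n
  _∧̇_  : Formula n → Formula n → Formula n
  _∨̇_  : Formula n → Formula n → Formula n
  ⋀    : {I : Set} → Countable I → (I → Formula n) → Formula n
  ⋁    : {I : Set} → Countable I → (I → Formula n) → Formula n
  ∀̇_   : Formula (suc n) → Formula n
  ∃̇_   : Formula (suc n) → Formula n

Sentence : Set₁
Sentence = Formula 0

data QuantifierFree {n : ℕ} : Formula n → Set₁ where
  _≐_ : ∀ s t → QuantifierFree (s ≐ t)
  P   : ∀ s t → QuantifierFree (P s t)
  ¬̇_  : ∀ {φ} → QuantifierFree φ → QuantifierFree (¬̇ φ)
  _∧̇_ : ∀ {φ ψ} → QuantifierFree φ → QuantifierFree ψ → QuantifierFree (φ ∧̇ ψ)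
  _∨̇_ : ∀ {φ ψ} → QuantifierFree φ → QuantifierFree ψ → QuantifierFree (φ ∨̇ ψ)

-- `Is∃Π< α φ` says that φ is ∃ȳ ψ for a finite, possibly empty, tuple ȳ and some
-- ψ that is Π_β with β < α; `Is∀Σ< α φ` is the dual.
mutual
  data IsΣ (α : Ordinal) {n : ℕ} : Formula n → Set₁ where
    base : ∀ {φ} → IsZero α → QuantifierFree φ → IsΣ α φ
    ⋁    : ∀ {I : Set} (c : Countable I) {φ : I → Formula n} →
           IsPositive α → (∀ i → Is∃Π< α (φ i)) → IsΣ α (⋁ c φ)

  data IsΠ (α : Ordinal) {n : ℕ} : Formula n → Set₁ where
    base : ∀ {φ} → IsZero α → QuantifierFree φ → IsΠ α φ
    ⋀    : ∀ {I : Set} (c : Countable I) {φ : I → Formula n} →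
           IsPositive α → (∀ i → Is∀Σ< α (φ i)) → IsΠ α (⋀ c φ)

  data Is∃Π< (α : Ordinal) {n : ℕ} : Formula n → Set₁ where
    matrix : ∀ {β ψ} → β ≺ α → IsΠ β ψ → Is∃Π< α ψ
    ∃̇_     : ∀ {φ} → Is∃Π< α φ → Is∃Π< α (∃̇ φ)

  data Is∀Σ< (α : Ordinal) {n : ℕ} : Formula n → Set₁ where
    matrix : ∀ {β ψ} → β ≺ α → IsΣ β ψ → Is∀Σ< α ψ
    ∀̇_     : ∀ {φ} → Is∀Σ< α φ → Is∀Σ< α (∀̇ φ)

------------------------------------------------------------------------
-- Countable structures, satisfaction, Scott sentences and Scott rank

record Structure : Set₁ where
  field
    Carrier   : Set
    countable : Countable Carrier
    rootᴬ     : Carrier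
    Pᴬ        : Rel Carrier 0ℓ

record _≅_ (A B : Structure) : Set where
  private
    module A = Structure A
    module B = Structure B
  field
    bijection : A.Carrier ↔ B.Carrier
  open Inverse bijection public using (to)
  field
    root-pres : to A.rootᴬ ≡ B.rootᴬ
    P-pres    : ∀ x y → A.Pᴬ x y ⇔ B.Pᴬ (to x) (to y)

module Satisfaction (A : Structure) where
  open Structure A

  ⟦_⟧ : ∀ {n} → Term n → Vec Carrier n → Carrier
  ⟦ var i ⟧ ρ = lookup ρ i
  ⟦ r     ⟧ ρ = rootᴬ

  Sat : ∀ {n} → Formula n → Vec Carrier n → Set
  Sat (s ≐ t)  ρ = ⟦ s ⟧ ρ ≡ ⟦ t ⟧ ρ
  Sat (P s t)  ρ = Pᴬ (⟦ s ⟧ ρ) (⟦ t ⟧ ρ)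
  Sat (¬̇ φ)    ρ = ¬ Sat φ ρ
  Sat (φ ∧̇ ψ)  ρ = Sat φ ρ × Sat ψ ρ
  Sat (φ ∨̇ ψ)  ρ = Sat φ ρ ⊎ Sat ψ ρ
  Sat (⋀ c φ)  ρ = ∀ i → Sat (φ i) ρ
  Sat (⋁ c φ)  ρ = ∃[ i ] Sat (φ i) ρ
  Sat (∀̇ φ)    ρ = ∀ a → Sat φ (a ∷ ρ)
  Sat (∃̇ φ)    ρ = ∃[ a ] Sat φ (a ∷ ρ)

infix 4 _≼_ _≺_ _≅_ _⊨_

_⊨_ : Structure → Sentence → Set
A ⊨ φ = Satisfaction.Sat A φ []

IsScottSentence : Sentence → Structure → Set₁
IsScottSentence θ A = ∀ (B : Structure) → B ⊨ θ ⇔ B ≅ A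

HasΠScottSentence : Ordinal → Structure → Set₁
HasΠScottSentence α A = Σ[ θ ∈ Sentence ] IsΠ α θ × IsScottSentence θ A

IsScottRank : Ordinal → Structure → Set₁
IsScottRank α A =
  HasΠScottSentence (α +ₒ 1) A ×
  (∀ (β : Ordinal) → HasΠScottSentence (β +ₒ 1) A → α ≼ β)

ScottRankAtMost : Ordinal → Structure → Set₁
ScottRankAtMost β A = Σ[ α ∈ Ordinal ] IsScottRank α A × α ≼ β

------------------------------------------------------------------------
-- Trees

module Walks {V : Set} (_—_ : Rel V 0ℓ) where

  Walk : Rel V 0ℓ
  Walk = Star _—_

  vertices : ∀ {x y} → Walk x y → List V
  vertices {x} ε       = x ∷ []
  vertices {x} (_ ◅ w) = x ∷ vertices w

  IsPath : ∀ {x y} → Walk x y → Set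
  IsPath w = Unique (vertices w)

  -- A cycle is a path on at least three vertices whose endpoints are adjacent.
  Acyclic : Set
  Acyclic = ∀ {x y} (w : Walk x y) → IsPath w → 3 ≤ length (vertices w) → ¬ (y — x)

record Tree : Set₁ where
  field
    Vertex      : Set
    countable   : Countable Vertex
    _—_         : Rel Vertex 0ℓ
    symmetric   : Symmetric _—_
    irreflexive : Irreflexive _≡_ _—_
  open Walks _—_ public
  field
    connected   : ∀ x y → Walk x y
    acyclic     : Acyclic
    root        : Vertex

  -- y is the parent of x: the second vertex on a path from x to the root.  No
  -- such y exists when x is the root, since the path would visit it twice.
  IsParent : Rel Vertex 0ℓ
  IsParent x y = Σ[ e ∈ x — y ] Σ[ w ∈ Walk y root ] IsPath (e ◅ w)

treeStructure : Tree → Structure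
treeStructure T = record
  { Carrier   = Vertex
  ; countable = countable
  ; rootᴬ     = root
  ; Pᴬ        = IsParent
  }
  where open Tree T

{-# OPTIONS --safe #-}
-- Play a back-and-forth game on a tree whose moves add finitely many vertices
-- together with all their ancestors; level-b equivalence in this game refines
-- Π_b-equivalence, and relative to a vertex it only sees the subtree below it.
-- Call two vertices of the given model T similar if their subtrees are equivalent
-- at level α, and pick a representative of every class.  The tree A unfolds T along
-- the representatives: the children of a node over x are those of the representative
-- of x.  Then A is equivalent to T at level α, hence a model of φ, and the subtree at
-- a node of A is determined up to isomorphism by its class.  Among the nodes of A
-- each class is Π_{α+1}-definable, and the sentence saying which class the root has
-- and how many children of each class a node of a given class has is Π_{α+3} and
-- characterises A: siblings of equal class are matched by their rank in an
-- enumeration.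
module Submission where

open import Defs
open import Data.Bool.Base using (Bool; true; false; if_then_else_)
open import Data.Empty using (⊥)
open import Data.Fin.Base using (Fin; zero; suc; fromℕ<)
open import Data.Fin.Properties using (fromℕ<-injective; injective⇒≤)
open import Data.List.Base as List using (List; []; _∷_)
open import Data.List.Membership.Propositional using (_∈_; _∉_)
import Data.List.Properties as List
open import Data.List.Relation.Binary.Pointwise as ListPointwise using ([]; _∷_)
open import Data.List.Relation.Unary.All as All using (All; []; _∷_)
open import Data.List.Relation.Unary.All.Properties using (¬Any⇒All¬)
open import Data.List.Relation.Unary.AllPairs using ([]; _∷_)
open import Data.List.Relation.Unary.Any using (here; there)
open import Data.Maybe.Base as Maybe using (just; nothing)
open import Data.Nat.Base using (ℕ; zero; suc; _+_; z≤n; s≤s; s≤s⁻¹) renaming (_≤_ to _≤ⁿ_; _<_ to _<ⁿ_)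
import Data.Nat.Binary.Base as ℕᵇ
open import Data.Nat.Binary.Base using (ℕᵇ; 2[1+_]; 1+[2_])
open import Data.Nat.Binary.Properties using (1+[2_]-injective) renaming (toℕ-injective to toℕᵇ-injective)
open import Data.Nat.Induction using (<-wellFounded)
open import Data.Nat.Properties using (suc-injective; ≤-refl; ≤-trans; ≤-reflexive; <⇒≢; <-cmp; m≤n⇒m<n∨m≡n; m≤n⇒m≤1+n; 1+n≰n; ≰⇒>)
open import Data.Product.Base using (Σ; Σ-syntax; ∃; ∃-syntax; ∃₂; _×_; _,_; proj₁; proj₂)
open import Data.Sum.Base as Sum using (_⊎_; inj₁; inj₂)
open import Data.Unit.Base using (⊤; tt)
open import Data.Vec.Base as Vec using (Vec; []; _∷_; _++_; lookup; allFin)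
open import Data.Vec.Properties using (lookup-map; map-∘; map-lookup-allFin)
open import Data.Vec.Relation.Binary.Pointwise.Inductive as Pointwise using (Pointwise; []; _∷_)
open import Data.Vec.Relation.Unary.All as VecAll using ([]; _∷_)
open import Function.Base using (id; _on_)
open import Function.Bundles using (_⇔_; mk⇔; mk↣; mk↔ₛ′; Equivalence; Injection; Inverse)
open import Function.Construct.Composition using (_↔-∘_)
open import Function.Construct.Identity using (↔-id)
open import Function.Definitions using (Injective)
import Function.Properties.Equivalence as ⇔
open import Induction.WellFounded using (WellFounded; Acc; acc)
open import Relation.Binary.Construct.Add.Supremum.Strict using ([_]; [_]<⊤⁺)
open import Relation.Binary.Construct.Closure.ReflexiveTransitive as Star using (Star; ε; _◅_; _◅◅_)
import Relation.Binary.Construct.On as On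
open import Relation.Binary.Definitions using (Tri; tri<; tri≈; tri>)
open import Relation.Binary.PropositionalEquality using (_≡_; _≢_; refl; sym; trans; cong; cong₂; subst; resp₂; isEquivalence)
open import Relation.Binary.Structures using (IsStrictTotalOrder)
open import Relation.Nullary using (¬_; yes; no; contradiction; recompute)
open import Relation.Nullary.Decidable using (decidable-stable)

open Equivalence using (to; from)
open Structure using (Carrier; rootᴬ; Pᴬ)
open Satisfaction using (Sat; ⟦_⟧)

-- Countable index sets

-- Removing a finite set of vertices closed under ancestors leaves pieces that do not interact: each
-- is a subtree with finitely many children of its top vertex cut off. The game therefore splits
-- into independent games on these pieces, and a subtree may be exchanged for an equivalent one
-- without disturbing the rest. The constant 3 arises as follows. For a fixed node a, "has every Π_α
-- property of a" is Π_α, because inside one countable structure countably many descriptions of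
-- moves suffice. Equivalence also needs the converse, which is expressed by excluding every node
-- that is not below a: one negation, hence Π_{α+1}. "At least k children of class d" is existential
-- over this, so denying it is Π_{α+2}, and saying that no node of class c denies it is Π_{α+3}.
-- "Every node has a class" costs the same. The defining formulas are controlled only inside `A`. In
-- other structures they may mean anything; the sentence itself forces them to partition the
-- vertices, and the counts then determine the tree.

code : ∀ {A : Set} → Countable A → A → ℕ
code = Injection.to

code-injective : ∀ {A : Set} (c : Countable A) → Injective _≡_ _≡_ (code c)
code-injective = Injection.injective

-- n is written 1ⁿ0 in front of k, a prefix-free code.
prefix : ℕ → ℕᵇ → ℕᵇ
prefix zero    k = 2[1+ k ]
prefix (suc n) k = 1+[2 prefix n k ]

prefix-injective : ∀ m n {k l} → prefix m k ≡ prefix n l → m ≡ n × k ≡ l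
prefix-injective zero    zero    refl = refl , refl
prefix-injective (suc m) (suc n) e    with refl , eq ← prefix-injective m n (1+[2_]-injective e) = refl , eq

pair : ℕ → ℕ → ℕ
pair m n = ℕᵇ.toℕ (prefix m (prefix n ℕᵇ.zero))

pair-injective : ∀ {m n m′ n′} → pair m n ≡ pair m′ n′ → m ≡ m′ × n ≡ n′
pair-injective {m} {n} {m′} {n′} e
  with p , q ← prefix-injective m m′ (toℕᵇ-injective e)
  = p , proj₁ (prefix-injective n n′ q)

×-countable : ∀ {A B : Set} → Countable A → Countable B → Countable (A × B)
×-countable cA cB = mk↣ {to = λ (a , b) → pair (code cA a) (code cB b)} λ e →
  let p , q = pair-injective e in cong₂ _,_ (code-injective cA p) (code-injective cB q)

List-countable : ∀ {A : Set} → Countable A → Countable (List A)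
List-countable {A} cA = mk↣ (λ {xs} {ys} → injective xs ys)
  where
  encode : List A → ℕ
  encode []       = zero
  encode (x ∷ xs) = suc (pair (code cA x) (encode xs))

  injective : ∀ xs ys → encode xs ≡ encode ys → xs ≡ ys
  injective []       []       _ = refl
  injective (x ∷ xs) (y ∷ ys) e =
    let p , q = pair-injective (suc-injective e) in
    cong₂ _∷_ (code-injective cA p) (injective xs ys q)

-- Ordinals

module OrdinalProperties (α : Ordinal) where
  open Ordinal α public renaming (_<_ to infix 4 _<_)
  open IsStrictTotalOrder isStrictTotalOrder public
    using (irrefl; compare; _<?_) renaming (trans to <-trans; asym to <-asym)

  -- The irrelevance of `bounded` makes equality of segment elements equality in α.
  record Segment (b : Elt) : Set where
    constructor _∣_
    field
      elt    : Elt
      .bounded : elt < b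

  open Segment public

  elt<bound : ∀ {b} (x : Segment b) → elt x < b
  elt<bound {b} (x ∣ x<b) = recompute (x <? b) x<b

  elt-injective : ∀ {b} {x y : Segment b} → elt x ≡ elt y → x ≡ y
  elt-injective refl = refl

  seg : Elt → Ordinal
  seg b = record
    { Elt                = Segment b
    ; _<_                = _<_ on elt
    ; isStrictTotalOrder = record
      { isStrictPartialOrder = record
        { isEquivalence = isEquivalence
        ; irrefl        = λ { refl → irrefl refl }
        ; trans         = <-trans
        ; <-resp-≈      = resp₂ (_<_ on elt)
        }
      ; compare = tri
      }
    ; wellFounded        = On.wellFounded elt wellFounded
    ; countable          = mk↣ (λ e → elt-injective (code-injective countable e))
    }
    where
    tri : (x y : Segment b) → Tri (elt x < elt y) (x ≡ y) (elt y < elt x)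
    tri x y with compare (elt x) (elt y)
    ... | tri< p q s = tri< p (λ e → q (cong elt e)) s
    ... | tri≈ p q s = tri≈ p (elt-injective q) s
    ... | tri> p q s = tri> p (λ e → q (cong elt e)) s

  seg≺ : ∀ b → seg b ≺ α
  seg≺ b = record
    { bound = b ; embed = elt ; mono = λ x<y → x<y
    ; image = mk⇔ (λ x<b → (_ ∣ x<b) , refl) λ { (x , refl) → elt<bound x }
    }

  seg-mono-≺ : ∀ {b c} → c < b → seg c ≺ seg b
  seg-mono-≺ {b} {c} c<b = record
    { bound = c ∣ c<b
    ; embed = λ x → elt x ∣ <-trans (elt<bound x) c<b
    ; mono  = λ x<y → x<y
    ; image = mk⇔ (λ x<c → (_ ∣ x<c) , refl) λ { (x , refl) → elt<bound x }
    }

≺-osuc : ∀ α → α ≺ osuc α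
≺-osuc α = record
  { bound = nothing ; embed = just ; mono = [_]
  ; image = mk⇔ (λ { [ x ]<⊤⁺ → x , refl }) λ { (x , refl) → [ x ]<⊤⁺ }
  }

module Monotone (α β : Ordinal) (f : Ordinal.Elt α → Ordinal.Elt β)
                (f-mono : ∀ {x y} → Ordinal._<_ α x y → Ordinal._<_ β (f x) (f y)) where
  private
    module α = OrdinalProperties α
    module β = OrdinalProperties β

  reflect : ∀ {x y} → f x β.< f y → x α.< y
  reflect {x} {y} fx<fy with α.compare x y
  ... | tri< x<y _ _ = x<y
  ... | tri≈ _ refl _ = contradiction fx<fy (β.irrefl refl)
  ... | tri> _ _ y<x = contradiction (f-mono y<x) (β.<-asym fx<fy)

≺-trans : ∀ {α β γ} → α ≺ β → β ≺ γ → α ≺ γ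
≺-trans {α} {β} {γ} p q = record
  { bound = q.embed p.bound
  ; embed = λ x → q.embed (p.embed x)
  ; mono  = λ x<y → q.mono (p.mono x<y)
  ; image = mk⇔ image→ λ { (x , refl) → q.mono (from p.image (x , refl)) }
  }
  where
  module p = _≺_ p
  module q = _≺_ q
  module γ = OrdinalProperties γ
  image→ : ∀ {b} → b γ.< q.embed p.bound → ∃[ x ] q.embed (p.embed x) ≡ b
  image→ b< with to q.image (γ.<-trans b< (from q.image (_ , refl)))
  ... | y , refl with to p.image (Monotone.reflect β γ q.embed q.mono b<)
  ...   | x , refl = x , refl

-- Classical principles and least elements

module Choice (em : Classical) where

  dne : ∀ {a} {A : Set a} → ¬ ¬ A → A
  dne = decidable-stable em

  ¬∀⇒∃¬ : ∀ {a b} {A : Set a} {B : A → Set b} → ¬ (∀ x → B x) → ∃[ x ] ¬ B x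
  ¬∀⇒∃¬ ¬f = dne λ ¬e → ¬f λ x → dne λ ¬b → ¬e (x , ¬b)

  wf-least : ∀ {ℓ} {A : Set} {_<_ : A → A → Set} → WellFounded _<_ → (Q : A → Set ℓ) →
             ∃ Q → ∃[ x ] Q x × (∀ {y} → y < x → ¬ Q y)
  wf-least {A = A} {_<_} wf Q (x , q) = go (wf x) q
    where
    go : ∀ {x} → Acc _<_ x → Q x → ∃[ x ] Q x × (∀ {y} → y < x → ¬ Q y)
    go {x} (acc rs) q with em {P = ∃[ y ] (y < x) × Q y}
    ... | yes (y , y<x , q′) = go (rs y<x) q′
    ... | no none            = x , q , λ y<x q′ → none (_ , y<x , q′)

  zero-below : ∀ {α} → IsPositive α → Σ[ ζ ∈ Ordinal ] ζ ≺ α × IsZero ζ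
  zero-below {α} x with wf-least (Ordinal.wellFounded α) (λ _ → Ordinal.Elt α) (x , x)
  ... | b , _ , least = seg b , seg≺ b , λ y → least (elt<bound y) x
    where open OrdinalProperties α

-- Definability by Π_β formulas

renameᵗ : ∀ {m n} → Vec (Fin m) n → Term n → Term m
renameᵗ σ (var i) = var (lookup σ i)
renameᵗ σ r       = r

extend : ∀ {m n} → Vec (Fin m) n → Vec (Fin (suc m)) (suc n)
extend σ = zero ∷ Vec.map suc σ

rename : ∀ {m n} → Vec (Fin m) n → Formula n → Formula m
rename σ (s ≐ t) = renameᵗ σ s ≐ renameᵗ σ t
rename σ (P s t) = P (renameᵗ σ s) (renameᵗ σ t)
rename σ (¬̇ φ)   = ¬̇ rename σ φ
rename σ (φ ∧̇ ψ) = rename σ φ ∧̇ rename σ ψ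
rename σ (φ ∨̇ ψ) = rename σ φ ∨̇ rename σ ψ
rename σ (⋀ c φ) = ⋀ c (λ i → rename σ (φ i))
rename σ (⋁ c φ) = ⋁ c (λ i → rename σ (φ i))
rename σ (∀̇ φ)   = ∀̇ rename (extend σ) φ
rename σ (∃̇ φ)   = ∃̇ rename (extend σ) φ

rename-quantifierFree : ∀ {m n} (σ : Vec (Fin m) n) {φ} → QuantifierFree φ → QuantifierFree (rename σ φ)
rename-quantifierFree σ (s ≐ t) = renameᵗ σ s ≐ renameᵗ σ t
rename-quantifierFree σ (P s t) = P (renameᵗ σ s) (renameᵗ σ t)
rename-quantifierFree σ (¬̇ q)   = ¬̇ rename-quantifierFree σ q
rename-quantifierFree σ (p ∧̇ q) = rename-quantifierFree σ p ∧̇ rename-quantifierFree σ q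
rename-quantifierFree σ (p ∨̇ q) = rename-quantifierFree σ p ∨̇ rename-quantifierFree σ q

mutual
  rename-Π : ∀ {β m n} (σ : Vec (Fin m) n) {φ} → IsΠ β φ → IsΠ β (rename σ φ)
  rename-Π σ (base z q)  = base z (rename-quantifierFree σ q)
  rename-Π σ (⋀ c pos f) = ⋀ c pos λ i → rename-∀Σ σ (f i)

  rename-Σ : ∀ {β m n} (σ : Vec (Fin m) n) {φ} → IsΣ β φ → IsΣ β (rename σ φ)
  rename-Σ σ (base z q)  = base z (rename-quantifierFree σ q)
  rename-Σ σ (⋁ c pos f) = ⋁ c pos λ i → rename-∃Π σ (f i)

  rename-∀Σ : ∀ {β m n} (σ : Vec (Fin m) n) {φ} → Is∀Σ< β φ → Is∀Σ< β (rename σ φ)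
  rename-∀Σ σ (matrix p s) = matrix p (rename-Σ σ s)
  rename-∀Σ σ (∀̇ s)        = ∀̇ rename-∀Σ (extend σ) s

  rename-∃Π : ∀ {β m n} (σ : Vec (Fin m) n) {φ} → Is∃Π< β φ → Is∃Π< β (rename σ φ)
  rename-∃Π σ (matrix p s) = matrix p (rename-Π σ s)
  rename-∃Π σ (∃̇ s)        = ∃̇ rename-∃Π (extend σ) s

reindex : ∀ {A : Set} {m n} → Vec (Fin m) n → Vec A m → Vec A n
reindex σ ρ = Vec.map (lookup ρ) σ

reindex-extend : ∀ {A : Set} {m n} (σ : Vec (Fin m) n) (a : A) ρ →
                 reindex (extend σ) (a ∷ ρ) ≡ a ∷ reindex σ ρ
reindex-extend σ a ρ = cong (a ∷_) (sym (map-∘ _ _ σ))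

rename-⟦⟧ : ∀ B {m n} (σ : Vec (Fin m) n) t ρ → ⟦ B ⟧ (renameᵗ σ t) ρ ≡ ⟦ B ⟧ t (reindex σ ρ)
rename-⟦⟧ B σ (var i) ρ = sym (lookup-map i (lookup ρ) σ)
rename-⟦⟧ B σ r       ρ = refl

mutual
  rename-sat→ : ∀ B {m n} (σ : Vec (Fin m) n) φ {ρ} → Sat B (rename σ φ) ρ → Sat B φ (reindex σ ρ)
  rename-sat→ B σ (s ≐ t) {ρ} e rewrite rename-⟦⟧ B σ s ρ | rename-⟦⟧ B σ t ρ = e
  rename-sat→ B σ (P s t) {ρ} e rewrite rename-⟦⟧ B σ s ρ | rename-⟦⟧ B σ t ρ = e
  rename-sat→ B σ (¬̇ φ)   ¬e       = λ e → ¬e (rename-sat← B σ φ e)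
  rename-sat→ B σ (φ ∧̇ ψ) (e , e′) = rename-sat→ B σ φ e , rename-sat→ B σ ψ e′
  rename-sat→ B σ (φ ∨̇ ψ) (inj₁ e) = inj₁ (rename-sat→ B σ φ e)
  rename-sat→ B σ (φ ∨̇ ψ) (inj₂ e) = inj₂ (rename-sat→ B σ ψ e)
  rename-sat→ B σ (⋀ c φ) e        = λ i → rename-sat→ B σ (φ i) (e i)
  rename-sat→ B σ (⋁ c φ) (i , e)  = i , rename-sat→ B σ (φ i) e
  rename-sat→ B σ (∀̇ φ) {ρ} e       = λ a →
    subst (Sat B φ) (reindex-extend σ a ρ) (rename-sat→ B (extend σ) φ (e a))
  rename-sat→ B σ (∃̇ φ) {ρ} (a , e) =
    a , subst (Sat B φ) (reindex-extend σ a ρ) (rename-sat→ B (extend σ) φ e)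

  rename-sat← : ∀ B {m n} (σ : Vec (Fin m) n) φ {ρ} → Sat B φ (reindex σ ρ) → Sat B (rename σ φ) ρ
  rename-sat← B σ (s ≐ t) {ρ} e rewrite rename-⟦⟧ B σ s ρ | rename-⟦⟧ B σ t ρ = e
  rename-sat← B σ (P s t) {ρ} e rewrite rename-⟦⟧ B σ s ρ | rename-⟦⟧ B σ t ρ = e
  rename-sat← B σ (¬̇ φ)   ¬e       = λ e → ¬e (rename-sat→ B σ φ e)
  rename-sat← B σ (φ ∧̇ ψ) (e , e′) = rename-sat← B σ φ e , rename-sat← B σ ψ e′
  rename-sat← B σ (φ ∨̇ ψ) (inj₁ e) = inj₁ (rename-sat← B σ φ e)
  rename-sat← B σ (φ ∨̇ ψ) (inj₂ e) = inj₂ (rename-sat← B σ ψ e)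
  rename-sat← B σ (⋀ c φ) e        = λ i → rename-sat← B σ (φ i) (e i)
  rename-sat← B σ (⋁ c φ) (i , e)  = i , rename-sat← B σ (φ i) e
  rename-sat← B σ (∀̇ φ) {ρ} e       = λ a →
    rename-sat← B (extend σ) φ (subst (Sat B φ) (sym (reindex-extend σ a ρ)) (e a))
  rename-sat← B σ (∃̇ φ) {ρ} (a , e) =
    a , rename-sat← B (extend σ) φ (subst (Sat B φ) (sym (reindex-extend σ a ρ)) e)

-- Semantic predicates and a calculus of their definability

Pred : ℕ → Set₁
Pred n = (B : Structure) → Vec (Carrier B) n → Set

infix 4 _≈_
_≈_ : ∀ {n} → Pred n → Pred n → Set₁
X ≈ Y = ∀ B ρ → X B ρ ⇔ Y B ρ

infix  8 ∼_
infixr 6 _∩_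
∼_ : ∀ {n} → Pred n → Pred n
(∼ X) B ρ = ¬ X B ρ

_∩_ : ∀ {n} → Pred n → Pred n → Pred n
(X ∩ Y) B ρ = X B ρ × Y B ρ

⋂ : ∀ {n} {I : Set} → (I → Pred n) → Pred n
⋂ X B ρ = ∀ i → X i B ρ

∀ᵖ ∃ᵖ : ∀ {n} → Pred (suc n) → Pred n
∀ᵖ X B ρ = ∀ a → X B (a ∷ ρ)
∃ᵖ X B ρ = ∃[ a ] X B (a ∷ ρ)

_∘ᵖ_ : ∀ {m n} → Pred n → Vec (Fin m) n → Pred m
(X ∘ᵖ σ) B ρ = X B (reindex σ ρ)

sat : ∀ {n} → Formula n → Pred n
sat φ B ρ = Sat B φ ρ

-- The equivalence ranges over all structures, since the Scott sentence is evaluated in structures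
-- that need not be trees.
record Definable (β : Ordinal) {n} (X : Pred n) : Set₁ where
  constructor definable
  field
    {formula} : Formula n
    isΠ       : IsΠ β formula
    spec      : sat formula ≈ X

Definable-resp : ∀ {β n} {X Y : Pred n} → X ≈ Y → Definable β X → Definable β Y
Definable-resp e (definable p s) = definable p λ B ρ → ⇔.trans (s B ρ) (e B ρ)

Definable-reindex : ∀ {β m n} {X : Pred n} (σ : Vec (Fin m) n) → Definable β X → Definable β (X ∘ᵖ σ)
Definable-reindex σ (definable {φ} p s) = definable (rename-Π σ p) λ B ρ →
  ⇔.trans (mk⇔ (rename-sat→ B σ φ) (rename-sat← B σ φ)) (s B (reindex σ ρ))

Σ-countable : ∀ {I : Set} {J : I → Set} → Countable I → (∀ i → Countable (J i)) → Countable (Σ I J)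
Σ-countable {I} {J} c d = mk↣ {to = encode} injective
  where
  encode : Σ I J → ℕ
  encode (i , j) = pair (code c i) (code (d i) j)

  injective : ∀ {x y} → encode x ≡ encode y → x ≡ y
  injective e with p , q ← pair-injective e with refl ← code-injective c p =
    cong (_ ,_) (code-injective (d _) q)

Bool-countable : Countable Bool
Bool-countable = mk↣ {to = λ b → if b then 0 else 1} λ { {true} {true} _ → refl ; {false} {false} _ → refl }

unit-countable : Countable ⊤
unit-countable = mk↣ {to = λ _ → 0} λ _ → refl

∀Σ-mono : ∀ {β γ n} {φ : Formula n} → γ ≺ β → Is∀Σ< γ φ → Is∀Σ< β φ
∀Σ-mono γ≺β (matrix p s) = matrix (≺-trans p γ≺β) s
∀Σ-mono γ≺β (∀̇ s)        = ∀̇ ∀Σ-mono γ≺β s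

module Calculus (em : Classical) where
  open Choice em

  mutual
    dualΠ : ∀ {β n} {φ : Formula n} → IsΠ β φ → Σ[ ψ ∈ Formula n ] IsΣ β ψ × (sat ψ ≈ ∼ sat φ)
    dualΠ (base {φ} z q) = ¬̇ φ , base z (¬̇ q) , λ B ρ → ⇔.refl
    dualΠ (⋀ c pos f)    =
      ⋁ c (λ i → proj₁ (dual∀Σ (f i))) , ⋁ c pos (λ i → proj₁ (proj₂ (dual∀Σ (f i)))) , λ B ρ → mk⇔
        (λ (i , e) all → to (proj₂ (proj₂ (dual∀Σ (f i))) B ρ) e (all i))
        (λ ¬all → let i , ¬s = ¬∀⇒∃¬ ¬all in i , from (proj₂ (proj₂ (dual∀Σ (f i))) B ρ) ¬s)

    dualΣ : ∀ {β n} {φ : Formula n} → IsΣ β φ → Σ[ ψ ∈ Formula n ] IsΠ β ψ × (sat ψ ≈ ∼ sat φ)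
    dualΣ (base {φ} z q) = ¬̇ φ , base z (¬̇ q) , λ B ρ → ⇔.refl
    dualΣ (⋁ c pos f)    =
      ⋀ c (λ i → proj₁ (dual∃Π (f i))) , ⋀ c pos (λ i → proj₁ (proj₂ (dual∃Π (f i)))) , λ B ρ → mk⇔
        (λ e (i , s) → to (proj₂ (proj₂ (dual∃Π (f i))) B ρ) (e i) s)
        (λ ¬ex i → from (proj₂ (proj₂ (dual∃Π (f i))) B ρ) λ s → ¬ex (i , s))

    dual∀Σ : ∀ {β n} {φ : Formula n} → Is∀Σ< β φ → Σ[ ψ ∈ Formula n ] Is∃Π< β ψ × (sat ψ ≈ ∼ sat φ)
    dual∀Σ (matrix p s) with ψ , d , e ← dualΣ s = ψ , matrix p d , e
    dual∀Σ (∀̇ s)        with ψ , d , e ← dual∀Σ s = ∃̇ ψ , ∃̇ d , λ B ρ → mk⇔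
      (λ (a , t) all → to (e B (a ∷ ρ)) t (all a))
      (λ ¬all → let a , ¬s = ¬∀⇒∃¬ ¬all in a , from (e B (a ∷ ρ)) ¬s)

    dual∃Π : ∀ {β n} {φ : Formula n} → Is∃Π< β φ → Σ[ ψ ∈ Formula n ] Is∀Σ< β ψ × (sat ψ ≈ ∼ sat φ)
    dual∃Π (matrix p s) with ψ , d , e ← dualΠ s = ψ , matrix p d , e
    dual∃Π (∃̇ s)        with ψ , d , e ← dual∃Π s = ∀̇ ψ , ∀̇ d , λ B ρ → mk⇔
      (λ t (a , s) → to (e B (a ∷ ρ)) (t a) s)
      (λ ¬ex a → from (e B (a ∷ ρ)) λ s → ¬ex (a , s))

  Definable-∼ : ∀ {β γ n} {X : Pred n} → γ ≺ β → Definable γ X → Definable β (∼ X)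
  Definable-∼ γ≺β (definable p s) with ψ , d , e ← dualΠ p =
    definable (⋀ unit-countable (_≺_.bound γ≺β) λ _ → matrix γ≺β d) λ B ρ → mk⇔
      (λ t x → to (e B ρ) (t tt) (from (s B ρ) x))
      (λ ¬x _ → from (e B ρ) λ t → ¬x (to (s B ρ) t))

  Definable-mono : ∀ {β γ n} {X : Pred n} → γ ≺ β → Definable γ X → Definable β X
  Definable-mono γ≺β (definable (base z q) s) =
    definable (⋀ unit-countable (_≺_.bound γ≺β) λ _ → matrix γ≺β (base z q)) λ B ρ →
      mk⇔ (λ t → to (s B ρ) (t tt)) (λ x _ → from (s B ρ) x)
  Definable-mono γ≺β (definable (⋀ c pos f) s) =
    definable (⋀ c (_≺_.bound γ≺β) λ i → ∀Σ-mono γ≺β (f i)) s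

  Definable-quantifierFree : ∀ {β n} {φ : Formula n} → QuantifierFree φ → Definable β (sat φ)
  Definable-quantifierFree {β} q with em {P = IsPositive β}
  ... | no zero′ = definable (base zero′ q) λ B ρ → ⇔.refl
  ... | yes pos  = let ζ , ζ≺β , z = zero-below pos in
    Definable-mono ζ≺β (definable (base z q) λ B ρ → ⇔.refl)

  Definable-⊤ : ∀ {β n} → Definable β {n} (λ _ _ → ⊤)
  Definable-⊤ = Definable-resp (λ B ρ → mk⇔ (λ _ → tt) λ _ → refl) (Definable-quantifierFree (r ≐ r))

  -- `C` is a fact of the metatheory and not a formula: it decides whether a conjunct is kept or
  -- made trivial. A family of conjuncts can thus be indexed by a fixed countable set and selected
  -- by what is true in `A`.
  Definable-guard : ∀ {β n} {X : Pred n} (C : Set) → (C → Definable β X) → Definable β (λ B ρ → C → X B ρ)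
  Definable-guard C d with em {P = C}
  ... | yes c = Definable-resp (λ B ρ → mk⇔ (λ x _ → x) λ f → f c) (d c)
  ... | no ¬c = Definable-resp (λ B ρ → mk⇔ (λ _ c → contradiction c ¬c) λ _ → tt) Definable-⊤

  Conjuncts : ∀ β {n} → Pred n → Set₁
  Conjuncts β {n} X = Σ[ I ∈ Set ] Σ[ c ∈ Countable I ] Σ[ φ ∈ (I → Formula n) ]
    (∀ i → Is∀Σ< β (φ i)) × (sat (⋀ c φ) ≈ X)

  conjuncts : ∀ {β n} {X : Pred n} → IsPositive β → Definable β X → Conjuncts β X
  conjuncts pos (definable (base z q) s)  = contradiction pos z
  conjuncts pos (definable (⋀ c _ f) s) = _ , c , _ , f , s

  -- A conjunction at level β may not contain Π_β formulas as members, so the conjuncts of all the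
  -- members are merged into one conjunction over a dependent sum.
  Definable-⋂ : ∀ {β n} {I : Set} {X : I → Pred n} → IsPositive β → Countable I →
                (∀ i → Definable β (X i)) → Definable β (⋂ X)
  Definable-⋂ pos c d =
    definable (⋀ (Σ-countable c λ i → proj₁ (proj₂ (N i))) pos λ (i , j) → proj₁ (proj₂ (proj₂ (proj₂ (N i)))) j) λ B ρ → mk⇔
      (λ t i → to (spec′ i B ρ) λ j → t (i , j))
      (λ x (i , j) → from (spec′ i B ρ) (x i) j)
    where
    N = λ i → conjuncts pos (d i)
    spec′ = λ i → proj₂ (proj₂ (proj₂ (proj₂ (N i))))

  Definable-∀ : ∀ {β n} {X : Pred (suc n)} → IsPositive β → Definable β X → Definable β (∀ᵖ X)
  Definable-∀ pos d with I , c , φ , f , s ← conjuncts pos d =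
    definable (⋀ c pos λ i → ∀̇ f i) λ B ρ → mk⇔
      (λ t a → to (s B (a ∷ ρ)) λ i → t i a)
      (λ x i a → from (s B (a ∷ ρ)) (x a) i)

  Definable-∩ : ∀ {β n} {X Y : Pred n} → Definable β X → Definable β Y → Definable β (X ∩ Y)
  Definable-∩ {β} {n} {X} {Y} dX dY with em {P = IsPositive β}
  ... | yes pos = Definable-resp
      (λ B ρ → mk⇔ (λ f → f true , f false) λ { (x , y) true → x ; (x , y) false → y })
      (Definable-⋂ {X = λ b → if b then X else Y} pos Bool-countable λ { true → dX ; false → dY })
  Definable-∩ (definable (base _ p) s) (definable (base z q) t) | no _ =
    definable (base z (p ∧̇ q)) λ B ρ → mk⇔
      (λ (x , y) → to (s B ρ) x , to (t B ρ) y) (λ (x , y) → from (s B ρ) x , from (t B ρ) y)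
  Definable-∩ (definable (⋀ _ pos _) _) _ | no z = contradiction pos z
  Definable-∩ _ (definable (⋀ _ pos _) _) | no z = contradiction pos z

  -- An existential block kept apart from the level of its matrix. Blocks can be merged across
  -- conjunctions, and negating one gives a universal block, which a higher Π level absorbs at no
  -- further cost.
  data ∃Definable (β : Ordinal) : ∀ {n} → Pred n → Set₁ where
    matrix : ∀ {n} {X : Pred n} → Definable β X → ∃Definable β X
    ex     : ∀ {n} {X : Pred (suc n)} {Y : Pred n} → ∃Definable β X → ∃ᵖ X ≈ Y → ∃Definable β Y

  ∃Definable-resp : ∀ {β n} {X Y : Pred n} → X ≈ Y → ∃Definable β X → ∃Definable β Y
  ∃Definable-resp e (matrix d) = matrix (Definable-resp e d)
  ∃Definable-resp e (ex d e′)  = ex d λ B ρ → ⇔.trans (e′ B ρ) (e B ρ)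

  ∃Definable-reindex : ∀ {β m n} {X : Pred n} (σ : Vec (Fin m) n) → ∃Definable β X → ∃Definable β (X ∘ᵖ σ)
  ∃Definable-reindex σ (matrix d) = matrix (Definable-reindex σ d)
  ∃Definable-reindex σ (ex {X = X} d e) = ex (∃Definable-reindex (extend σ) d) λ B ρ → mk⇔
    (λ (a , x) → to (e B _) (a , subst (X B) (reindex-extend σ a ρ) x))
    (λ y → let a , x = from (e B _) y in a , subst (X B) (sym (reindex-extend σ a ρ)) x)

  weakening : ∀ n → Vec (Fin (suc n)) n
  weakening n = Vec.map suc (allFin n)

  reindex-weakening : ∀ {A : Set} {n} (a : A) (ρ : Vec A n) → reindex (weakening n) (a ∷ ρ) ≡ ρ
  reindex-weakening {n = n} a ρ = trans (sym (map-∘ _ _ (allFin n))) (map-lookup-allFin ρ)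

  ∃Definable-weaken : ∀ {β n} {X : Pred n} → ∃Definable β X → ∃Definable β {suc n} (λ B ρ → X B (Vec.tail ρ))
  ∃Definable-weaken {X = X} d = ∃Definable-resp
    (λ { B (a ∷ ρ) → mk⇔ (subst (X B) (reindex-weakening a ρ)) (subst (X B) (sym (reindex-weakening a ρ))) })
    (∃Definable-reindex (weakening _) d)

  Definable-weaken : ∀ {β n} {X : Pred n} → Definable β X → Definable β {suc n} (λ B ρ → X B (Vec.tail ρ))
  Definable-weaken {X = X} d = Definable-resp
    (λ { B (a ∷ ρ) → mk⇔ (subst (X B) (reindex-weakening a ρ)) (subst (X B) (sym (reindex-weakening a ρ))) })
    (Definable-reindex (weakening _) d)

  ∃Definable-∩ : ∀ {β n} {X Y : Pred n} → ∃Definable β X → ∃Definable β Y → ∃Definable β (X ∩ Y)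
  ∃Definable-∩ (ex d e) d′ = ex (∃Definable-∩ d (∃Definable-weaken d′)) λ B ρ → mk⇔
    (λ (a , x , y) → to (e B ρ) (a , x) , y)
    (λ (x , y) → let a , x′ = from (e B ρ) x in a , x′ , y)
  ∃Definable-∩ (matrix d) d′ = matrix-∩ d d′
    where
    matrix-∩ : ∀ {β n} {X Y : Pred n} → Definable β X → ∃Definable β Y → ∃Definable β (X ∩ Y)
    matrix-∩ d (matrix d′) = matrix (Definable-∩ d d′)
    matrix-∩ d (ex d′ e)   = ex (matrix-∩ (Definable-weaken d) d′) λ B ρ → mk⇔
      (λ (a , x , y) → x , to (e B ρ) (a , y))
      (λ (x , y) → let a , y′ = from (e B ρ) y in a , x , y′)

  Definable-∼∃ : ∀ {β γ n} {X : Pred n} → γ ≺ β → ∃Definable γ X → Definable β (∼ X)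
  Definable-∼∃ γ≺β (matrix d) = Definable-∼ γ≺β d
  Definable-∼∃ γ≺β (ex d e)   = Definable-resp
    (λ B ρ → mk⇔ (λ f y → let a , x = from (e B ρ) y in f a x) λ ¬y a x → ¬y (to (e B ρ) (a , x)))
    (Definable-∀ (_≺_.bound γ≺β) (Definable-∼∃ γ≺β d))

-- Trees as structures

-- Axioms for trees in the language {r, P}. They can be written in the infinitary logic, which
-- allows the Scott sentence to impose them on arbitrary structures.
record Rooted (S : Structure) : Set where
  private module S = Structure S
  field
    parent-unique : ∀ {x y z} → S.Pᴬ x y → S.Pᴬ x z → y ≡ z
    root-orphan   : ∀ {y} → ¬ S.Pᴬ S.rootᴬ y
    ancestry      : ∀ x → Star S.Pᴬ x S.rootᴬ

  -- Parents are unique, so the ascent given by `ancestry` is the only one, and it ends at the root.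
  parent-wellFounded : WellFounded (λ y x → S.Pᴬ x y)
  parent-wellFounded x = go (ancestry x)
    where
    go : ∀ {x} → Star S.Pᴬ x S.rootᴬ → Acc (λ y x → S.Pᴬ x y) x
    go ε       = acc λ p → contradiction p root-orphan
    go (p ◅ s) = acc λ q → subst (Acc _) (parent-unique p q) (go s)

  no-cycle : ∀ {x y} → S.Pᴬ x y → ¬ Star S.Pᴬ y x
  no-cycle {x} = go (parent-wellFounded x)
    where
    go : ∀ {x y} → Acc (λ y x → S.Pᴬ x y) x → S.Pᴬ x y → ¬ Star S.Pᴬ y x
    go (acc rs) p ε       = go (rs p) p ε
    go (acc rs) p (q ◅ s) = go (rs p) q (s ◅◅ (p ◅ ε))

open Rooted

-- Rooted structures and trees as graphs

module WalkProperties {V : Set} (_—_ : V → V → Set) where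
  open Walks _—_

  end∈vertices : ∀ {x y} (w : Walk x y) → y ∈ vertices w
  end∈vertices ε       = here refl
  end∈vertices (e ◅ w) = there (end∈vertices w)

  start∈vertices : ∀ {x y} (w : Walk x y) → x ∈ vertices w
  start∈vertices ε       = here refl
  start∈vertices (e ◅ w) = here refl

module TreeProperties (em : Classical) where

  treeStructure-rooted : ∀ T → Rooted (treeStructure T)
  treeStructure-rooted T = record
    { parent-unique = λ {x} p q → Choice.dne em (two-parents p q)
    ; root-orphan   = λ { (e , w , avoid ∷ _) → All.lookup avoid (end∈vertices w) refl }
    ; ancestry      = λ x → let w , p , _ = shorten (connected x root) in climb w p
    }
    where
    open Tree T
    open WalkProperties _—_

    -- Inclusion of the visited vertices, in the form in which it is applied: shortening a walk that
    -- avoids `x` keeps it away from `x`.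
    Preserves : ∀ {x y z} → Walk x z → Walk y z → Set₁
    Preserves v w = ∀ {Q : Vertex → Set} → All Q (vertices w) → All Q (vertices v)

    drop-until : ∀ {x y z} (w : Walk y z) → IsPath w → x ∈ vertices w →
                 Σ[ v ∈ Walk x z ] IsPath v × Preserves v w
    drop-until ε       p       (here refl) = ε , p , λ q → q
    drop-until (e ◅ w) p       (here refl) = e ◅ w , p , λ q → q
    drop-until (e ◅ w) (_ ∷ p) (there i)   =
      let v , p′ , pres = drop-until w p i in v , p′ , λ { (_ ∷ q) → pres q }

    shorten : ∀ {x y} (w : Walk x y) → Σ[ v ∈ Walk x y ] IsPath v × Preserves v w
    shorten ε = ε , [] ∷ [] , λ q → q
    shorten {x} (e ◅ w) with shorten w
    ... | v , p , pres with em {P = x ∈ vertices v}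
    ...   | yes i = let u , p′ , pres′ = drop-until v p i in u , p′ , λ { (_ ∷ q) → pres′ (pres q) }
    ...   | no ¬i = e ◅ v , ¬Any⇒All¬ _ ¬i ∷ p , λ { (q ∷ qs) → q ∷ pres qs }

    climb : ∀ {x} (w : Walk x root) → IsPath w → Star IsParent x root
    climb ε       _           = ε
    climb (e ◅ w) p@(_ ∷ p′) = (e , w , p) ◅ climb w p′

    Avoiding : Vertex → Vertex → Vertex → Set
    Avoiding x y z = Σ[ w ∈ Walk y z ] All (x ≢_) (vertices w)

    append : ∀ {x a b c} → Avoiding x a b → Avoiding x b c → Avoiding x a c
    append (ε , _) v = v
    append (e ◅ w , n ∷ ns) v = let u , q = append (w , ns) v in e ◅ u , n ∷ q

    backward : ∀ {x a b} → Avoiding x a b → Avoiding x b a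
    backward (ε , q)          = ε , q
    backward (e ◅ w , n ∷ ns) =
      append (backward (w , ns)) (symmetric e ◅ ε , All.lookup ns (start∈vertices w) ∷ n ∷ [])

    -- The two paths to the root avoid `x` after their first edge. Joined at the root and shortened,
    -- they connect `y` to `z` away from `x`, which closes a cycle through `x`.
    two-parents : ∀ {x y z} → IsParent x y → IsParent x z → ¬ y ≢ z
    two-parents (e , w , a ∷ _) (e′ , w′ , a′ ∷ _) y≢z
      with u , b ← append (w , a) (backward (w′ , a′))
      with shorten u
    ... | ε , p , pres = y≢z refl
    ... | v@(_ ◅ ε) , p , pres = acyclic (e ◅ v) (pres b ∷ p) (s≤s (s≤s (s≤s z≤n))) (symmetric e′)
    ... | v@(_ ◅ _ ◅ _) , p , pres = acyclic (e ◅ v) (pres b ∷ p) (s≤s (s≤s (s≤s z≤n))) (symmetric e′)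

  module FromRooted {S : Structure} (rooted : Rooted S) where
    open Structure S renaming (Carrier to Node; Pᴬ to Parent; rootᴬ to top)

    _—_ : Node → Node → Set
    x — y = Parent x y ⊎ Parent y x

    open WalkProperties _—_
    open Walks _—_

    -- The only edge across the boundary of the subtree at `x` joins `x` to its parent, so a walk
    -- that comes in passes through `x`.
    entering : ∀ {x u v} (w : Walk u v) → ¬ Star Parent u x → Star Parent v x → x ∈ vertices w
    entering ε ¬d d = contradiction d ¬d
    entering {x} (_◅_ {j = u} e w) ¬d d with em {P = Star Parent u x}
    entering (e ◅ w)      ¬d d | no ¬d′      = there (entering w ¬d′ d)
    entering (inj₁ p ◅ w) ¬d d | yes s       = contradiction (p ◅ s) ¬d
    entering (inj₂ p ◅ w) ¬d d | yes ε       = there (start∈vertices w)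
    entering (inj₂ p ◅ w) ¬d d | yes (q ◅ s) =
      contradiction (subst (λ v → Star Parent v _) (parent-unique rooted q p) s) ¬d

    -- The same boundary seen from inside: the way out of the subtree at `z` leads to its parent
    -- `x`.
    leaving : ∀ {x z u v} (w : Walk u v) → Parent z x → Star Parent u z → ¬ Star Parent v z → x ∈ vertices w
    leaving ε zx d ¬d = contradiction d ¬d
    leaving {x} {z} (_◅_ {j = u} e w) zx d ¬d with em {P = Star Parent u z}
    leaving (e ◅ w)      zx d       ¬d | yes d′ = there (leaving w zx d′ ¬d)
    leaving (inj₁ p ◅ w) zx ε       ¬d | no ¬d′ with refl ← parent-unique rooted p zx = there (start∈vertices w)
    leaving (inj₁ p ◅ w) zx (q ◅ s) ¬d | no ¬d′ with refl ← parent-unique rooted p q = contradiction s ¬d′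
    leaving (inj₂ p ◅ w) zx d       ¬d | no ¬d′ = contradiction (p ◅ d) ¬d′

    -- A cycle that starts upwards returns from a child of `x`, as parents are unique, and so has
    -- entered the subtree at `x` through `x` itself. A cycle that starts into a child `z` has to
    -- leave the subtree at `z` through `x`. Either way `x` is repeated.
    acyclic : Acyclic
    acyclic ε _ (s≤s ())
    acyclic (e ◅ ε) _ (s≤s (s≤s ()))
    acyclic {x} {y} (e ◅ w@(_◅_ {i = z} _ w′)) (x∉ ∷ z∉ ∷ _) _ closing = cases e closing
      where
      z≢y : z ≢ y
      z≢y = All.lookup z∉ (end∈vertices w′)

      cases : x — z → y — x → ⊥
      cases (inj₁ xz) (inj₁ yx) =
        All.lookup x∉ (entering w (no-cycle rooted xz) (yx ◅ ε)) refl
      cases (inj₁ xz) (inj₂ xy) = z≢y (parent-unique rooted xz xy)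
      cases (inj₂ zx) closing   = All.lookup x∉ (leaving w zx ε (outside closing)) refl
        where
        outside : y — x → ¬ Star Parent y z
        outside (inj₂ xy) s       = no-cycle rooted xy (s ◅◅ (zx ◅ ε))
        outside (inj₁ yx) ε       = z≢y refl
        outside (inj₁ yx) (q ◅ s) with refl ← parent-unique rooted q yx = no-cycle rooted zx s

    upward : ∀ {x y} → Star Parent x y → Walk x y
    upward = Star.map inj₁

    downward : ∀ {x y} → Star Parent x y → Walk y x
    downward s = Star.reverse Sum.swap (upward s)

    tree : Tree
    tree = record
      { Vertex      = Node
      ; countable   = countable
      ; _—_         = _—_
      ; symmetric   = Sum.swap
      ; irreflexive = λ { refl (inj₁ p) → no-cycle rooted p ε ; refl (inj₂ p) → no-cycle rooted p ε }
      ; connected   = λ x y → upward (ancestry rooted x) ◅◅ downward (ancestry rooted y)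
      ; acyclic     = acyclic
      ; root        = top
      }

    open Tree tree using (IsParent)

    upward-avoids : ∀ {x y z} → ¬ Star Parent y x → (s : Star Parent y z) → All (x ≢_) (vertices (upward s))
    upward-avoids ¬d ε       = (λ { refl → ¬d ε }) ∷ []
    upward-avoids ¬d (p ◅ s) = (λ { refl → ¬d ε }) ∷ upward-avoids (λ d → ¬d (p ◅ d)) s

    isParent⇔ : ∀ {x y} → IsParent x y ⇔ Parent x y
    isParent⇔ = mk⇔ only-parent (λ p → inj₁ p , upward (ancestry rooted _) , upward-path (p ◅ ancestry rooted _))
      where
      upward-path : ∀ {x y} (s : Star Parent x y) → IsPath (upward s)
      upward-path ε       = [] ∷ []
      upward-path (p ◅ s) = upward-avoids (no-cycle rooted p) s ∷ upward-path s

      only-parent : ∀ {x y} → IsParent x y → Parent x y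
      only-parent (inj₁ p , _ , _)      = p
      -- Here `w` climbs from a child of `x` to the root, hence passes through `x`, which the path
      -- condition forbids.
      only-parent (inj₂ p , w , x∉ ∷ _) =
        contradiction refl (All.lookup x∉ (leaving w p ε λ { ε → root-orphan rooted p ; (q ◅ _) → root-orphan rooted q }))

-- The back-and-forth game on trees

-- A state (x , E) stands for the subtree at x with the children in E cut off.
State : Set → Set
State V = V × List V

-- A move in a state (x , E) is a finite set of descendants of x, closed under
-- parents: `grow c l m` selects a child c ∉ E of x, then l below c, and goes on
-- with m in the state (x , c ∷ E).  Each occurrence of `stop` is left in a state.
data Move (V : Set) : Set where
  stop : Move V
  grow : V → Move V → Move V → Move V

Legal : ∀ S → Move (Carrier S) → State (Carrier S) → Set
Legal S stop         _       = ⊤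
Legal S (grow c l m) (x , E) = Pᴬ S c x × c ∉ E × Legal S l (c , []) × Legal S m (x , c ∷ E)

-- Moves of different shape never match. `R` is imposed at the `stop` leaves alone, because the
-- states left there are the independent pieces on which the game continues.
Matched : ∀ {U V : Set} → (State U → State V → Set) → Move U → State U → Move V → State V → Set
Matched R stop         s       stop            t        = R s t
Matched R (grow c l m) (x , E) (grow d l′ m′) (y , F) =
  Matched R l (c , []) l′ (d , []) × Matched R m (x , c ∷ E) m′ (y , d ∷ F)
Matched R _ _ _ _ = ⊥

module _ {U V : Set} where

  Matched-map : ∀ {R R′ : State U → State V → Set} → (∀ {s t} → R s t → R′ s t) →
                ∀ l {s} l′ {t} → Matched R l s l′ t → Matched R′ l s l′ t
  Matched-map f stop         stop            p       = f p
  Matched-map f (grow c l m) (grow d l′ m′) (p , q) = Matched-map f l l′ p , Matched-map f m m′ q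

  Matched-trans : ∀ {W : Set} {R : State U → State V → Set} {R′ : State V → State W → Set}
                    {R″ : State U → State W → Set} → (∀ {s t u} → R s t → R′ t u → R″ s u) →
                  ∀ l {s} l′ {t} l″ {u} → Matched R l s l′ t → Matched R′ l′ t l″ u → Matched R″ l s l″ u
  Matched-trans f stop         stop            stop            p       p′        = f p p′
  Matched-trans f (grow c l m) (grow _ l′ m′) (grow _ l″ m″) (p , q) (p′ , q′) =
    Matched-trans f l l′ l″ p p′ , Matched-trans f m m′ m″ q q′

Matched-refl : ∀ {V : Set} {R : State V → State V → Set} → (∀ {s} → R s s) → ∀ l {s} → Matched R l s l s
Matched-refl f stop         = f
Matched-refl f (grow c l m) = Matched-refl f l , Matched-refl f m

-- `At l l′ a b`: a and b have the same position in l and l′.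
At : ∀ {U V : Set} → Move U → Move V → U → V → Set
At (grow c l m) (grow d l′ m′) a b = (a ≡ c × b ≡ d) ⊎ At l l′ a b ⊎ At m m′ a b
At _ _ _ _ = ⊥

At-swap : ∀ {U V : Set} (l : Move U) (l′ : Move V) {a b} → At l l′ a b → At l′ l b a
At-swap (grow c l m) (grow d l′ m′) (inj₁ (p , q))    = inj₁ (q , p)
At-swap (grow c l m) (grow d l′ m′) (inj₂ (inj₁ p)) = inj₂ (inj₁ (At-swap l l′ p))
At-swap (grow c l m) (grow d l′ m′) (inj₂ (inj₂ p)) = inj₂ (inj₂ (At-swap m m′ p))

Mem : ∀ {V : Set} → Move V → V → Set
Mem stop         a = ⊥
Mem (grow c l m) a = a ≡ c ⊎ Mem l a ⊎ Mem m a

Mem⇒At : ∀ {U V : Set} {R : State U → State V → Set} l {s} l′ {t} → Matched R l s l′ t →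
         ∀ {a} → Mem l a → ∃[ b ] At l l′ a b
Mem⇒At (grow c l m) (grow d l′ m′) (p , q) (inj₁ e)        = d , inj₁ (e , refl)
Mem⇒At (grow c l m) (grow d l′ m′) (p , q) (inj₂ (inj₁ i)) = let b , i′ = Mem⇒At l l′ p i in b , inj₂ (inj₁ i′)
Mem⇒At (grow c l m) (grow d l′ m′) (p , q) (inj₂ (inj₂ i)) = let b , i′ = Mem⇒At m m′ q i in b , inj₂ (inj₂ i′)

infix 4 _⊆ᵐ_
_⊆ᵐ_ : ∀ {V : Set} → Move V → Move V → Set
stop       ⊆ᵐ _            = ⊤
grow c l m ⊆ᵐ grow d l′ m′ = c ≡ d × l ⊆ᵐ l′ × m ⊆ᵐ m′
grow _ _ _ ⊆ᵐ stop         = ⊥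

⊆ᵐ-refl : ∀ {V : Set} (l : Move V) → l ⊆ᵐ l
⊆ᵐ-refl stop         = tt
⊆ᵐ-refl (grow c l m) = refl , ⊆ᵐ-refl l , ⊆ᵐ-refl m

⊆ᵐ-trans : ∀ {V : Set} (l l′ l″ : Move V) → l ⊆ᵐ l′ → l′ ⊆ᵐ l″ → l ⊆ᵐ l″
⊆ᵐ-trans stop l′ l″ _ _ = tt
⊆ᵐ-trans (grow c l m) (grow _ l′ m′) (grow _ l″ m″) (refl , p , q) (refl , p′ , q′) =
  refl , ⊆ᵐ-trans l l′ l″ p p′ , ⊆ᵐ-trans m m′ m″ q q′

Mem-mono : ∀ {V : Set} (l l′ : Move V) → l ⊆ᵐ l′ → ∀ {a} → Mem l a → Mem l′ a
Mem-mono (grow c l m) (grow _ l′ m′) (refl , p , q) = Sum.map id (Sum.map (Mem-mono l l′ p) (Mem-mono m m′ q))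

At-mono : ∀ {U V : Set} (l : Move U) (l′ : Move V) {k k′} → l ⊆ᵐ k → l′ ⊆ᵐ k′ →
          ∀ {a b} → At l l′ a b → At k k′ a b
At-mono (grow c l m) (grow d l′ m′) {grow _ k j} {grow _ k′ j′} (refl , p , q) (refl , p′ , q′) =
  Sum.map id (Sum.map (At-mono l l′ p p′) (At-mono m m′ q q′))

module _ {A B : Structure} where

  -- This is where closure of moves under parents enters: the parents of a pair are again a pair or
  -- the two base vertices, so paired vertices satisfy the same atomic formulas.
  At-parent : ∀ l {x E} l′ {y F} → Legal A l (x , E) → Legal B l′ (y , F) → ∀ {a b} → At l l′ a b →
              ∃₂ λ p q → Pᴬ A a p × Pᴬ B b q × ((p ≡ x × q ≡ y) ⊎ At l l′ p q)
  At-parent (grow c l m) (grow d l′ m′) (cx , _) (dy , _) (inj₁ (refl , refl)) =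
    _ , _ , cx , dy , inj₁ (refl , refl)
  At-parent (grow c l m) (grow d l′ m′) (cx , _ , L , _) (dy , _ , L′ , _) (inj₂ (inj₁ i))
    with At-parent l l′ L L′ i
  ... | p , q , ap , bq , inj₁ (e , e′) = p , q , ap , bq , inj₂ (inj₁ (e , e′))
  ... | p , q , ap , bq , inj₂ j        = p , q , ap , bq , inj₂ (inj₂ (inj₁ j))
  At-parent (grow c l m) (grow d l′ m′) (_ , _ , _ , M) (_ , _ , _ , M′) (inj₂ (inj₂ i))
    with At-parent m m′ M M′ i
  ... | p , q , ap , bq , inj₁ e = p , q , ap , bq , inj₁ e
  ... | p , q , ap , bq , inj₂ j = p , q , ap , bq , inj₂ (inj₂ (inj₂ j))

At-below : ∀ {A : Structure} {V : Set} l {x E} (l′ : Move V) → Legal A l (x , E) → ∀ {a b} → At l l′ a b →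
           ∃[ d ] Pᴬ A d x × d ∉ E × Star (Pᴬ A) a d
At-below (grow c l m) (grow d l′ m′) (cx , c∉ , _) (inj₁ (refl , _)) = c , cx , c∉ , ε
At-below {A} (grow c l m) (grow d l′ m′) (cx , c∉ , L , _) (inj₂ (inj₁ i))
  with e , ec , _ , s ← At-below {A} l l′ L i = c , cx , c∉ , s ◅◅ (ec ◅ ε)
At-below {A} (grow c l m) (grow d l′ m′) (_ , _ , _ , M) (inj₂ (inj₂ i))
  with e , ex , e∉ , s ← At-below {A} m m′ M i = e , ex , (λ j → e∉ (there j)) , s

module _ {A : Structure} (rooted : Rooted A) where

  child-above-unique : ∀ {a c d x} → Pᴬ A c x → Pᴬ A d x → Star (Pᴬ A) a c → Star (Pᴬ A) a d → c ≡ d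
  child-above-unique cx dx ε       ε       = refl
  child-above-unique cx dx ε       (p ◅ s) with refl ← parent-unique rooted cx p = contradiction s (no-cycle rooted dx)
  child-above-unique cx dx (p ◅ s) ε       with refl ← parent-unique rooted dx p = contradiction s (no-cycle rooted cx)
  child-above-unique cx dx (p ◅ s) (q ◅ t) with refl ← parent-unique rooted p q = child-above-unique cx dx s t

  -- A vertex occurs at one position only: `l` stays strictly below `c`, while `m` stays below
  -- children of `x` other than `c`.
  At-functional : ∀ {V : Set} l {x E} (l′ : Move V) → Legal A l (x , E) →
                  ∀ {a b b′} → At l l′ a b → At l l′ a b′ → b ≡ b′
  At-functional (grow c l m) (grow d l′ m′) (cx , _ , L , M) = cases
    where
    c∉l : ∀ {b} → ¬ At l l′ c b
    c∉l i with _ , ec , _ , s ← At-below {A} l l′ L i = no-cycle rooted ec s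

    below-c∉m : ∀ {a b} → Star (Pᴬ A) a c → ¬ At m m′ a b
    below-c∉m s i with e , ex , e∉ , t ← At-below {A} m m′ M i =
      e∉ (here (child-above-unique ex cx t s))

    l-below-c : ∀ {a b} → At l l′ a b → Star (Pᴬ A) a c
    l-below-c i with _ , ec , _ , s ← At-below {A} l l′ L i = s ◅◅ (ec ◅ ε)

    cases : ∀ {a b b′} → At (grow c l m) (grow d l′ m′) a b → At (grow c l m) (grow d l′ m′) a b′ → b ≡ b′
    cases (inj₁ (_ , refl))  (inj₁ (_ , refl))  = refl
    cases (inj₁ (refl , _))  (inj₂ (inj₁ i))  = contradiction i c∉l
    cases (inj₁ (refl , _))  (inj₂ (inj₂ i))  = contradiction i (below-c∉m ε)
    cases (inj₂ (inj₁ i)) (inj₁ (refl , _))   = contradiction i c∉l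
    cases (inj₂ (inj₁ i)) (inj₂ (inj₁ j))   = At-functional l l′ L i j
    cases (inj₂ (inj₁ i)) (inj₂ (inj₂ j))   = contradiction j (below-c∉m (l-below-c i))
    cases (inj₂ (inj₂ i)) (inj₁ (refl , _))   = contradiction i (below-c∉m ε)
    cases (inj₂ (inj₂ i)) (inj₂ (inj₁ j))   = contradiction i (below-c∉m (l-below-c j))
    cases (inj₂ (inj₂ i)) (inj₂ (inj₂ j))   = At-functional m m′ M i j

Paired : ∀ A B → Move (Carrier A) → Move (Carrier B) → Carrier A → Carrier B → Set
Paired A B l l′ a b = (a ≡ rootᴬ A × b ≡ rootᴬ B) ⊎ At l l′ a b

-- Levels are left out, so a position can be flipped, as negation demands, although `below` has a
-- direction.
record Position (A B : Structure) {n} (ρ : Vec (Carrier A) n) (ρ′ : Vec (Carrier B) n) : Set where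
  field
    {left}  : Move (Carrier A)
    {right} : Move (Carrier B)
    legalˡ  : Legal A left (rootᴬ A , [])
    legalʳ  : Legal B right (rootᴬ B , [])
    paired  : Pointwise (Paired A B left right) ρ ρ′

open Position

flip : ∀ {A B n} {ρ : Vec _ n} {ρ′} → Position A B ρ ρ′ → Position B A ρ′ ρ
flip pos = record
  { legalˡ = legalʳ pos ; legalʳ = legalˡ pos
  ; paired = Pointwise.sym (Sum.map (λ (p , q) → q , p) (At-swap (left pos) (right pos))) (paired pos)
  }

module _ {A B : Structure} (rootedᴬ : Rooted A) (rootedᴮ : Rooted B)
         {n} {ρ : Vec (Carrier A) n} {ρ′ : Vec (Carrier B) n} (pos : Position A B ρ ρ′) where

  private
    M : Carrier A → Carrier B → Set
    M = Paired A B (left pos) (right pos)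

  ⟦⟧-paired : ∀ t → M (⟦ A ⟧ t ρ) (⟦ B ⟧ t ρ′)
  ⟦⟧-paired (var i) = Pointwise.lookup (paired pos) i
  ⟦⟧-paired r       = inj₁ (refl , refl)

  Paired-functional : ∀ {a b b′} → M a b → M a b′ → b ≡ b′
  Paired-functional (inj₁ (_ , refl)) (inj₁ (_ , refl)) = refl
  Paired-functional (inj₁ (refl , _)) (inj₂ i)
    with _ , _ , p , _ ← At-parent {A} {B} (left pos) (right pos) (legalˡ pos) (legalʳ pos) i =
    contradiction p (root-orphan rootedᴬ)
  Paired-functional (inj₂ i) (inj₁ (refl , _))
    with _ , _ , p , _ ← At-parent {A} {B} (left pos) (right pos) (legalˡ pos) (legalʳ pos) i =
    contradiction p (root-orphan rootedᴬ)
  Paired-functional (inj₂ i) (inj₂ j) = At-functional rootedᴬ (left pos) (right pos) (legalˡ pos) i j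

  Paired-P : ∀ {a b a′ b′} → M a b → M a′ b′ → Pᴬ A a a′ → Pᴬ B b b′
  Paired-P (inj₁ (refl , _)) _ p = contradiction p (root-orphan rootedᴬ)
  Paired-P (inj₂ i) m p with At-parent {A} {B} (left pos) (right pos) (legalˡ pos) (legalʳ pos) i
  ... | _ , _ , q , q′ , m′ with refl ← parent-unique rootedᴬ p q =
    subst (Pᴬ B _) (Paired-functional m′ m) q′

preserves-quantifierFree : ∀ {A B} → Rooted A → Rooted B → ∀ {n} {φ : Formula n} {ρ ρ′} →
  QuantifierFree φ → Position A B ρ ρ′ → Sat A φ ρ → Sat B φ ρ′
preserves-quantifierFree {A} {B} RA RB {ρ′ = ρ′} (s ≐ t) pos e =
  Paired-functional RA RB pos (⟦⟧-paired RA RB pos s) 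
    (subst (λ a → Paired A B _ _ a (⟦ B ⟧ t ρ′)) (sym e) (⟦⟧-paired RA RB pos t))
preserves-quantifierFree RA RB (P s t) pos e = Paired-P RA RB pos (⟦⟧-paired RA RB pos s) (⟦⟧-paired RA RB pos t) e
preserves-quantifierFree RA RB (¬̇ q)   pos ¬e e = ¬e (preserves-quantifierFree RB RA q (flip pos) e)
preserves-quantifierFree RA RB (p ∧̇ q) pos (e , e′) =
  preserves-quantifierFree RA RB p pos e , preserves-quantifierFree RA RB q pos e′
preserves-quantifierFree RA RB (p ∨̇ q) pos =
  Sum.map (preserves-quantifierFree RA RB p pos) (preserves-quantifierFree RA RB q pos)

-- Back-and-forth relations and the preservation of formulas

module BackAndForth (ω : Ordinal) where
  open OrdinalProperties ω

  -- `B` moves and `A` answers; afterwards the roles are exchanged at a lower level. The recursion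
  -- is on accessibility since only the level decreases.
  below-acc : ∀ A B {b : Elt} → Acc _<_ b → State (Carrier A) → State (Carrier B) → Set
  below-acc A B {b} (acc rs) s t = ∀ {c} (c<b : c < b) l → Legal B l t →
    Σ[ l′ ∈ Move (Carrier A) ] Legal A l′ s × Matched (below-acc B A (rs c<b)) l t l′ s

  -- Every Π_b property of s in A holds of t in B.
  below : ∀ A B → Elt → State (Carrier A) → State (Carrier B) → Set
  below A B b = below-acc A B (wellFounded b)

  -- `below` starts from the canonical accessibility proof of its level, whereas the recursion
  -- yields others; the relations are shown to agree instead of identifying the proofs.
  below-acc-irrelevant : ∀ {A B b} (p q : Acc _<_ b) {s t} → below-acc A B p s t → below-acc A B q s t
  below-acc-irrelevant {A} {B} (acc rs) (acc rs′) h c<b l L with h c<b l L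
  ... | l′ , L′ , m = l′ , L′ , Matched-map (below-acc-irrelevant {B} {A} (rs c<b) (rs′ c<b)) l l′ m

  respond : ∀ {A B b c s t} → below A B b s t → c < b → ∀ l → Legal B l t →
            Σ[ l′ ∈ Move (Carrier A) ] Legal A l′ s × Matched (below B A c) l t l′ s
  respond {A} {B} {b} h c<b l L with wellFounded b
  ... | acc rs with l′ , L′ , m ← h c<b l L =
    l′ , L′ , Matched-map (below-acc-irrelevant {B} {A} (rs c<b) (wellFounded _)) l l′ m

  from-responses : ∀ {A B b s t} →
    (∀ {c} → c < b → ∀ l → Legal B l t → Σ[ l′ ∈ Move (Carrier A) ] Legal A l′ s × Matched (below B A c) l t l′ s) →
    below A B b s t
  from-responses {A} {B} {b} h with wellFounded b
  ... | acc rs = λ c<b l L → let l′ , L′ , m = h c<b l L in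
    l′ , L′ , Matched-map (below-acc-irrelevant {B} {A} (wellFounded _) (rs c<b)) l l′ m

  below-refl : ∀ {A b s} → below A A b s s
  below-refl {A} {b} = go (wellFounded b)
    where
    go : ∀ {b} → Acc _<_ b → ∀ {s} → below A A b s s
    go (acc rs) = from-responses λ c<b l L → l , L , Matched-refl (go (rs c<b)) l

  below-trans : ∀ {A B C b s t u} → below A B b s t → below B C b t u → below A C b s u
  below-trans {b = b} = go (wellFounded b)
    where
    go : ∀ {b} → Acc _<_ b → ∀ {A B C s t u} → below A B b s t → below B C b t u → below A C b s u
    go (acc rs) {A} {B} {C} {s} h h′ = from-responses λ c<b l L →
      let l′ , L′ , m = respond h′ c<b l L
          l″ , L″ , m′ = respond h c<b l′ L′
      in l″ , L″ , Matched-trans (go (rs c<b)) l l′ l″ m m′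

  Matched-below-trans : ∀ {A B C b} l {s} l′ {t} l″ {u} → Matched (below A B b) l s l′ t →
    Matched (below B C b) l′ t l″ u → Matched (below A C b) l s l″ u
  Matched-below-trans = Matched-trans below-trans

  -- Extending a matched move means moving at each of its `stop` leaves. The pieces there are
  -- independent, so the answers can be given leaf by leaf.
  respond-⊆ : ∀ {A B b c} → c < b → ∀ l {s} l′ {t} → Matched (below A B b) l s l′ t → Legal A l s →
    ∀ k′ → l′ ⊆ᵐ k′ → Legal B k′ t →
    Σ[ k ∈ Move (Carrier A) ] l ⊆ᵐ k × Legal A k s × Matched (below B A c) k′ t k s
  respond-⊆ c<b stop stop h _ k′ _ L′ with k , L , m ← respond h c<b k′ L′ = k , tt , L , m
  respond-⊆ c<b (grow c l m) (grow d l′ m′) (h , i) (cx , c∉ , L , M) (grow _ k′ j′) (refl , p , q) (_ , _ , L′ , M′)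
    with k , p′ , K , mk ← respond-⊆ c<b l l′ h L k′ p L′
       | j , q′ , J , mj ← respond-⊆ c<b m m′ i M j′ q M′ =
    grow c k j , (refl , p′ , q′) , (cx , c∉ , K , J) , mk , mj

  record FitsBelow (β : Ordinal) (b : Elt) : Set where
    field
      embed  : Ordinal.Elt β → Elt
      mono   : ∀ {x y} → Ordinal._<_ β x y → embed x < embed y
      bounds : ∀ x → embed x < b

  FitsBelow-≺ : ∀ {β γ b} (f : FitsBelow β b) (γ≺β : γ ≺ β) → FitsBelow γ (FitsBelow.embed f (_≺_.bound γ≺β))
  FitsBelow-≺ f γ≺β = record
    { embed  = λ x → embed (p.embed x)
    ; mono   = λ x<y → mono (p.mono x<y)
    ; bounds = λ x → mono (from p.image (x , refl))
    }
    where
    open FitsBelow f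
    module p = _≺_ γ≺β

  module Preservation (em : Classical) where

    module _ (S : Structure) where

      include-child : ∀ l {x E b} → Legal S l (x , E) → Pᴬ S b x → b ∉ E →
        Σ[ k ∈ Move (Carrier S) ] l ⊆ᵐ k × Legal S k (x , E) × Mem k b
      include-child stop {b = b} _ bx b∉ = grow b stop stop , tt , (bx , b∉ , tt , tt) , inj₁ refl
      include-child (grow c l m) {b = b} (cx , c∉ , L , M) bx b∉ with em {P = b ≡ c}
      ... | yes e = grow c l m , ⊆ᵐ-refl (grow c l m) , (cx , c∉ , L , M) , inj₁ e
      ... | no ne with k , p , K , i ← include-child m M bx (λ { (here e) → ne e ; (there j) → b∉ j }) =
        grow c l k , (refl , ⊆ᵐ-refl l , p) , (cx , c∉ , L , K) , inj₂ (inj₂ i)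

      include-child-of : ∀ l {s a b} → Legal S l s → Mem l a → Pᴬ S b a →
        Σ[ k ∈ Move (Carrier S) ] l ⊆ᵐ k × Legal S k s × Mem k b
      include-child-of (grow c l m) (cx , c∉ , L , M) (inj₁ refl) ba
        with k , p , K , i ← include-child l L ba (λ ()) =
        grow c k m , (refl , p , ⊆ᵐ-refl m) , (cx , c∉ , K , M) , inj₂ (inj₁ i)
      include-child-of (grow c l m) (cx , c∉ , L , M) (inj₂ (inj₁ j)) ba
        with k , p , K , i ← include-child-of l L j ba =
        grow c k m , (refl , p , ⊆ᵐ-refl m) , (cx , c∉ , K , M) , inj₂ (inj₁ i)
      include-child-of (grow c l m) (cx , c∉ , L , M) (inj₂ (inj₂ j)) ba
        with k , p , K , i ← include-child-of m M j ba =
        grow c l k , (refl , ⊆ᵐ-refl l , p) , (cx , c∉ , L , K) , inj₂ (inj₂ i)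

      Covers : Move (Carrier S) → Carrier S → Set
      Covers l b = b ≡ rootᴬ S ⊎ Mem l b

      -- A vertex joins a move only together with its ancestors, so its parent is included before
      -- it.
      include : ∀ l {b} → Star (Pᴬ S) b (rootᴬ S) → Legal S l (rootᴬ S , []) →
        Σ[ k ∈ Move (Carrier S) ] l ⊆ᵐ k × Legal S k (rootᴬ S , []) × Covers k b
      include l ε       L = l , ⊆ᵐ-refl l , L , inj₁ refl
      include l (p ◅ s) L with include l s L
      ... | k , q , K , inj₁ refl with j , q′ , J , i ← include-child k K p (λ ()) =
        j , ⊆ᵐ-trans l k j q q′ , J , inj₂ i
      ... | k , q , K , inj₂ i′ with j , q′ , J , i ← include-child-of k K i′ p =
        j , ⊆ᵐ-trans l k j q q′ , J , inj₂ i

      include-all : Rooted S → ∀ l {n} (bs : Vec (Carrier S) n) → Legal S l (rootᴬ S , []) →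
        Σ[ k ∈ Move (Carrier S) ] l ⊆ᵐ k × Legal S k (rootᴬ S , []) × VecAll.All (Covers k) bs
      include-all R l []       L = l , ⊆ᵐ-refl l , L , []
      include-all R l (b ∷ bs) L
        with k , p , K , c ← include l (ancestry R b) L
        with j , q , J , cs ← include-all R k bs K =
        j , ⊆ᵐ-trans l k j p q , J , Sum.map id (Mem-mono k j q) c ∷ cs

    partners : ∀ {A B} {R : State (Carrier A) → State (Carrier B) → Set} l {s} l′ {t} → Matched R l s l′ t →
      ∀ {n} {as : Vec (Carrier A) n} → VecAll.All (Covers A l) as →
      Σ[ bs ∈ Vec (Carrier B) n ] Pointwise (Paired A B l l′) as bs
    partners l l′ m [] = [] , []
    partners {A} {B} l l′ m (inj₁ e ∷ cs) with bs , ps ← partners {A} {B} l l′ m cs =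
      rootᴬ B ∷ bs , inj₁ (e , refl) ∷ ps
    partners {A} {B} l l′ m (inj₂ i ∷ cs) with bs , ps ← partners {A} {B} l l′ m cs =
      let b , j = Mem⇒At l l′ m i in b ∷ bs , inj₂ j ∷ ps

    module _ {A B : Structure} (RA : Rooted A) (RB : Rooted B) where

      MatchedAt : Elt → ∀ {n} {ρ : Vec (Carrier A) n} {ρ′} → Position A B ρ ρ′ → Set
      MatchedAt b pos = Matched (below A B b) (left pos) (rootᴬ A , []) (right pos) (rootᴬ B , [])

      enlarge : ∀ {b c n k} {ρ : Vec (Carrier A) n} {ρ′} → c < b → (pos : Position A B ρ ρ′) → MatchedAt b pos →
        (bs : Vec (Carrier B) k) →
        Σ[ as ∈ Vec (Carrier A) k ] Σ[ pos′ ∈ Position B A (bs ++ ρ′) (as ++ ρ) ]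
          Matched (below B A c) (left pos′) (rootᴬ B , []) (right pos′) (rootᴬ A , [])
      enlarge c<b pos h bs
        with k , p , K , cs ← include-all B RB (right pos) bs (legalʳ pos)
        with j , q , J , m ← respond-⊆ {A} {B} c<b (left pos) (right pos) h (legalˡ pos) k p K
        with as , ps ← partners {B} {A} k j m cs =
        as , record
          { legalˡ = K ; legalʳ = J
          ; paired = Pointwise.++⁺ ps (Pointwise.map (Sum.map id (At-mono (right pos) (left pos) p q)) (paired (flip pos)))
          } , m

    mutual
      preservesΠ : ∀ {A B} → Rooted A → Rooted B → ∀ {β b n} {φ : Formula n} {ρ ρ′} → IsΠ β φ → FitsBelow β b →
        (pos : Position A B ρ ρ′) → Matched (below A B b) (left pos) (rootᴬ A , []) (right pos) (rootᴬ B , []) →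
        Sat A φ ρ → Sat B φ ρ′
      preservesΠ RA RB (base _ q)  f pos h e   = preserves-quantifierFree RA RB q pos e
      preservesΠ RA RB (⋀ c _ φs) f pos h e i = preserves∀ RA RB (φs i) f pos h [] λ { [] → e i }

      preservesΣ : ∀ {A B} → Rooted A → Rooted B → ∀ {β b n} {φ : Formula n} {ρ ρ′} → IsΣ β φ → FitsBelow β b →
        (pos : Position B A ρ′ ρ) → Matched (below B A b) (left pos) (rootᴬ B , []) (right pos) (rootᴬ A , []) →
        Sat A φ ρ → Sat B φ ρ′
      preservesΣ RA RB (base _ q)  f pos h e       = preserves-quantifierFree RA RB q (flip pos) e
      preservesΣ RA RB (⋁ c _ φs) f pos h (i , e) = i , preserves∃ RA RB (φs i) f pos h [] e λ { [] e → e }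

      -- The whole block of quantifiers is collected in `bs` and answered by a single move at the
      -- matrix, because the level drops once per block and not once per quantifier.
      preserves∀ : ∀ {A B} → Rooted A → Rooted B → ∀ {β b n k} {φ : Formula (k + n)} {ρ ρ′} → Is∀Σ< β φ → FitsBelow β b →
        (pos : Position A B {n} ρ ρ′) → Matched (below A B b) (left pos) (rootᴬ A , []) (right pos) (rootᴬ B , []) →
        (bs : Vec (Carrier B) k) → (∀ as → Sat A φ (as ++ ρ)) → Sat B φ (bs ++ ρ′)
      preserves∀ RA RB (matrix γ≺β s) f pos h bs e
        with as , pos′ , h′ ← enlarge RA RB (FitsBelow.bounds f _) pos h bs =
        preservesΣ RA RB s (FitsBelow-≺ f γ≺β) pos′ h′ (e as)
      preserves∀ RA RB (∀̇ s) f pos h bs e = λ b → preserves∀ RA RB s f pos h (b ∷ bs) λ { (a ∷ as) → e as a }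

      -- All witnesses of the block appear together at the matrix; the continuation `result` hands
      -- them back to the quantifiers one at a time.
      preserves∃ : ∀ {A B} → Rooted A → Rooted B → ∀ {β b n k} {φ : Formula (k + n)} {ρ ρ′} → Is∃Π< β φ → FitsBelow β b →
        (pos : Position B A {n} ρ′ ρ) → Matched (below B A b) (left pos) (rootᴬ B , []) (right pos) (rootᴬ A , []) →
        (as : Vec (Carrier A) k) → Sat A φ (as ++ ρ) → {Goal : Set} → (∀ bs → Sat B φ (bs ++ ρ′) → Goal) → Goal
      preserves∃ RA RB (matrix γ≺β s) f pos h as e result
        with bs , pos′ , h′ ← enlarge RB RA (FitsBelow.bounds f _) pos h as =
        result bs (preservesΠ RA RB s (FitsBelow-≺ f γ≺β) pos′ h′ e)
      preserves∃ RA RB (∃̇ s) f pos h as (a , e) result =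
        preserves∃ RA RB s f pos h (a ∷ as) e λ { (b ∷ bs) e′ → result bs (b , e′) }

-- Definability of the back-and-forth classes of a fixed structure

Move-countable : ∀ {V : Set} → Countable V → Countable (Move V)
Move-countable {V} c = mk↣ (λ {l} {m} → injective l m)
  where
  encode : Move V → ℕ
  encode stop         = zero
  encode (grow v l m) = suc (pair (code c v) (pair (encode l) (encode m)))

  injective : ∀ l m → encode l ≡ encode m → l ≡ m
  injective stop         stop            _ = refl
  injective (grow v l m) (grow w l′ m′) e
    with p , q ← pair-injective {code c v} (suc-injective e)
    with q , s ← pair-injective {encode l} q
    with refl ← code-injective c p | refl ← injective l l′ q | refl ← injective m m′ s = refl

State-countable : ∀ {V : Set} → Countable V → Countable (State V)
State-countable c = ×-countable c (List-countable c)

fresh : ∀ {n} → List (Fin n) → Formula (suc n)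
fresh []      = r ≐ r
fresh (y ∷ L) = (¬̇ (var zero ≐ var (suc y))) ∧̇ fresh L

freshChild : ∀ {n} → Fin n → List (Fin n) → Formula (suc n)
freshChild z L = P (var zero) (var (suc z)) ∧̇ fresh L

freshChild-quantifierFree : ∀ {n} (z : Fin n) L → QuantifierFree (freshChild z L)
freshChild-quantifierFree z L = P _ _ ∧̇ go L
  where
  go : ∀ L → QuantifierFree (fresh L)
  go []      = r ≐ r
  go (y ∷ L) = (¬̇ (_ ≐ _)) ∧̇ go L

StatePred : Set₁
StatePred = (B : Structure) → State (Carrier B) → Set

stateAt : ∀ {V : Set} {n} → Fin n → List (Fin n) → Vec V n → State V
stateAt z L ρ = lookup ρ z , List.map (lookup ρ) L

atVars : ∀ {n} → StatePred → Fin n → List (Fin n) → Pred n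
atVars X z L B ρ = X B (stateAt z L ρ)

DefinableState : Ordinal → StatePred → Set₁
DefinableState β X = ∀ {n} (z : Fin n) L → Definable β (atVars X z L)

fresh-spec : ∀ B {n} (L : List (Fin n)) {a ρ} → Sat B (fresh L) (a ∷ ρ) ⇔ (a ∉ List.map (lookup ρ) L)
fresh-spec B L = mk⇔ (fresh→ L) (fresh← L)
  where
  fresh→ : ∀ {n} (L : List (Fin n)) {a ρ} → Sat B (fresh L) (a ∷ ρ) → a ∉ List.map (lookup ρ) L
  fresh→ (y ∷ L) (ne , f) (here e)  = ne e
  fresh→ (y ∷ L) (ne , f) (there i) = fresh→ L f i

  fresh← : ∀ {n} (L : List (Fin n)) {a ρ} → a ∉ List.map (lookup ρ) L → Sat B (fresh L) (a ∷ ρ)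
  fresh← []      _  = refl
  fresh← (y ∷ L) a∉ = (λ e → a∉ (here e)) , fresh← L (λ i → a∉ (there i))

stateAt-exclude : ∀ {V : Set} {n} (z : Fin n) L (a : V) ρ →
  stateAt (suc z) (zero ∷ List.map suc L) (a ∷ ρ) ≡ (lookup ρ z , a ∷ List.map (lookup ρ) L)
stateAt-exclude z L a ρ = cong (λ M → lookup ρ z , a ∷ M) (sym (List.map-∘ L))

-- The common existential step of two recursions: realising a `grow` and counting one more child.
FreshChild : StatePred → StatePred → StatePred
FreshChild Y Z B (x , E) = ∃[ a ] Pᴬ B a x × a ∉ E × Y B (a , []) × Z B (x , a ∷ E)

module Separation (em : Classical) where
  open Choice em
  open Calculus em

  ∃DefinableState : Ordinal → StatePred → Set₁
  ∃DefinableState β X = ∀ {n} (z : Fin n) L → ∃Definable β (atVars X z L)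

  FreshChild-definable : ∀ {β} Y Z → ∃DefinableState β Y → ∃DefinableState β Z → ∃DefinableState β (FreshChild Y Z)
  FreshChild-definable Y Z dY dZ z L =
    ex (∃Definable-∩ (matrix (Definable-quantifierFree (freshChild-quantifierFree z L)))
         (∃Definable-∩ (dY zero []) (dZ (suc z) (zero ∷ List.map suc L))))
      λ B ρ → mk⇔
        (λ (a , (p , f) , y , w) → a , p , to (fresh-spec B L) f , y , subst (Z B) (stateAt-exclude z L a ρ) w)
        (λ (a , p , a∉ , y , w) →
          a , (p , from (fresh-spec B L) a∉) , y , subst (Z B) (sym (stateAt-exclude z L a ρ)) w)

  Many : StatePred → ℕ → StatePred
  Many Q zero    = λ _ _ → ⊤
  Many Q (suc k) = FreshChild Q (Many Q k)

  Many-definable : ∀ {β} Q → DefinableState β Q → ∀ k → ∃DefinableState β (Many Q k)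
  Many-definable Q d zero    z L = matrix Definable-⊤
  Many-definable Q d (suc k) =
    FreshChild-definable Q (Many Q k) (λ z L → matrix (d z L)) (Many-definable Q d k)

  module _ (A : Structure) where

    -- A move is finite, so the existence of one shaped like `l` with prescribed properties at its
    -- leaves takes one existential block.
    Realised : (State (Carrier A) → StatePred) → Move (Carrier A) → State (Carrier A) → StatePred
    Realised Φ l s B t = Σ[ h ∈ Move (Carrier B) ] Legal B h t × Matched (λ u v → Φ u B v) l s h t

    Realised-definable : ∀ {β} Φ → (∀ s → DefinableState β (Φ s)) → ∀ l s → ∃DefinableState β (Realised Φ l s)
    Realised-definable Φ d stop s z L = ∃Definable-resp
      (λ B ρ → mk⇔ (λ p → stop , tt , p) λ { (stop , _ , p) → p })
      (matrix (d s z L))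
    Realised-definable Φ d (grow c l m) (x , E) z L = ∃Definable-resp
      (λ B ρ → mk⇔
        (λ (a , p , a∉ , (h , H , i) , (k , K , j)) → grow a h k , (p , a∉ , H , K) , i , j)
        (λ { (grow a h k , (p , a∉ , H , K) , i , j) → a , p , a∉ , (h , H , i) , (k , K , j) }))
      (FreshChild-definable (Realised Φ l (c , [])) (Realised Φ m (x , c ∷ E))
        (Realised-definable Φ d l (c , [])) (Realised-definable Φ d m (x , c ∷ E)) z L)

    module _ (ω : Ordinal) where
      open OrdinalProperties ω
      open BackAndForth ω

      -- `holds` makes sense in every structure but is compared with `below` inside `A` only. This
      -- permits a conjunction over the countably many states of `A`.
      record Separator (b : Elt) (s : State (Carrier A)) : Set₁ where
        field
          holds      : StatePred
          isDefinable : DefinableState (seg b) holds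
          spec       : ∀ t → holds A t ⇔ below A A b s t

      open Separator

      module SeparatorStep {b} (rec : ∀ {c} → c < b → ∀ s → Separator c s) (s : State (Carrier A)) where

        Index : Set
        Index = Segment b × Move (Carrier A) × State (Carrier A)

        holdsAt : Segment b → State (Carrier A) → StatePred
        holdsAt c u = holds (rec (elt<bound c) u)

        Answered : Index → Set
        Answered (c , l , u) = Σ[ h ∈ Move (Carrier A) ] Legal A h s × Matched (below A A (elt c)) l u h s

        -- An index `(c , l , u)` describes the moves whose leaf states have all the Π_c properties
        -- of the leaf states of `l` at `u`. The predicate says that `t` admits no move under a
        -- description that `s` cannot answer.
        Spoiling : StatePred
        Spoiling B t = ∀ i → ¬ Answered i → let c , l , u = i in ¬ Realised (holdsAt c) l u B t

        spoiling-definable : DefinableState (seg b) Spoiling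
        spoiling-definable z L with em {P = IsPositive (seg b)}
        -- At the least level the condition is vacuous, while an infinite conjunction would require
        -- a positive level.
        ... | no empty = Definable-resp (λ B ρ → mk⇔ (λ _ (c , _) → contradiction c empty) λ _ → tt) Definable-⊤
        ... | yes pos  = Definable-⋂ pos
          (×-countable (Ordinal.countable (seg b))
            (×-countable (Move-countable (Structure.countable A)) (State-countable (Structure.countable A))))
          λ (c , l , u) → Definable-guard _ λ _ →
            Definable-∼∃ (seg-mono-≺ (elt<bound c))
              (Realised-definable (holdsAt c) (λ v → isDefinable (rec (elt<bound c) v)) l u z L)

        spoiling-spec : ∀ t → Spoiling A t ⇔ below A A b s t
        spoiling-spec t = mk⇔ spoiling→ spoiling←
          where
          spoiling→ : Spoiling A t → below A A b s t
          -- An unanswered move `l` at `t` falls under its own description, with `u` taken to be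
          -- `t`.
          spoiling→ x = from-responses λ c<b l L → dne λ unanswered →
            x (_ ∣ c<b , l , t) unanswered
              (l , L , Matched-refl (λ {u} → from (spec (rec (elt<bound (_ ∣ c<b)) u) u) (below-refl {A})) l)

          spoiling← : below A A b s t → Spoiling A t
          -- An answer to the realising move `k` also answers the description `l`, by transitivity
          -- at every leaf.
          spoiling← h (c , l , u) unanswered (k , K , m) =
            let k′ , K′ , m′ = respond {A} {A} h (elt<bound c) k K in
            unanswered (k′ , K′ ,
              Matched-below-trans {A} {A} {A} l k k′ (Matched-map (λ {v} {w} → to (spec (rec (elt<bound c) v) w)) l k m) m′)

      separator : ∀ b s → Separator b s
      separator b = go (wellFounded b)
        where
        go : ∀ {b} → Acc _<_ b → ∀ s → Separator b s
        go (acc rs) s = record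
          { holds = Spoiling ; isDefinable = spoiling-definable ; spec = spoiling-spec }
          where open SeparatorStep (λ c<b → go (rs c<b)) s

-- Unfolding a tree along representatives of the back-and-forth classes

module Unfolding (em : Classical) (ω : Ordinal) (top : Ordinal.Elt ω) (T : Structure) (rootedᵀ : Rooted T) where
  open Choice em
  open Separation em
  open OrdinalProperties ω using (_<_; <-trans; wellFounded)
  open BackAndForth ω

  private
    V : Set
    V = Carrier T

    codeᵀ : V → ℕ
    codeᵀ = code (Structure.countable T)

  infix 4 _∼ᵀ_
  _∼ᵀ_ : V → V → Set
  x ∼ᵀ y = below T T top (x , []) (y , []) × below T T top (y , []) (x , [])

  ∼-trans : ∀ {x y z} → x ∼ᵀ y → y ∼ᵀ z → x ∼ᵀ z
  ∼-trans (p , p′) (q , q′) = below-trans {T} {T} {T} p q , below-trans {T} {T} {T} q′ p′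

  ∼-sym : ∀ {x y} → x ∼ᵀ y → y ∼ᵀ x
  ∼-sym (p , q) = q , p

  least-equivalent : ∀ x → ∃[ y ] y ∼ᵀ x × (∀ {z} → codeᵀ z <ⁿ codeᵀ y → ¬ z ∼ᵀ x)
  least-equivalent x =
    wf-least (On.wellFounded codeᵀ <-wellFounded) (_∼ᵀ x) (x , below-refl {T} , below-refl {T})

  rep : V → V
  rep x = proj₁ (least-equivalent x)

  rep-∼ : ∀ x → rep x ∼ᵀ x
  rep-∼ x = proj₁ (proj₂ (least-equivalent x))

  rep-cong : ∀ {x y} → x ∼ᵀ y → rep x ≡ rep y
  rep-cong {x} {y} x∼y with <-cmp (codeᵀ (rep x)) (codeᵀ (rep y))
  ... | tri< lt _ _ = contradiction (∼-trans (rep-∼ x) x∼y) (proj₂ (proj₂ (least-equivalent y)) lt)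
  ... | tri≈ _ eq _ = code-injective (Structure.countable T) eq
  ... | tri> _ _ gt = contradiction (∼-trans (rep-∼ y) (∼-sym x∼y)) (proj₂ (proj₂ (least-equivalent x)) gt)

  endpoint : List V → V
  endpoint []      = rep (rootᴬ T)
  endpoint (x ∷ _) = rep x

  Valid : List V → Set
  Valid []       = ⊤
  Valid (x ∷ xs) = Pᴬ T x (endpoint xs) × Valid xs

  -- Nodes are walks from the root, most recent vertex first, that jump from each
  -- vertex to its representative before descending to a child.
  record Node : Set where
    constructor node
    field
      path   : List V
      .valid : Valid path

  open Node using (path)

  path-injective : ∀ {a b : Node} → path a ≡ path b → a ≡ b
  path-injective refl = refl

  label : Node → V
  label a = endpoint (path a)

  rep-label : ∀ a → rep (label a) ≡ label a
  rep-label (node [] _)      = rep-cong (rep-∼ _)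
  rep-label (node (x ∷ _) _) = rep-cong (rep-∼ x)

  unfolded : Structure
  unfolded = record
    { Carrier   = Node
    ; countable = mk↣ (λ e → path-injective (code-injective (List-countable (Structure.countable T)) e))
    ; rootᴬ     = node [] tt
    ; Pᴬ        = λ a p → ∃[ x ] path a ≡ x ∷ path p
    }

  rooted : Rooted unfolded
  rooted = record
    { parent-unique = λ { (_ , p) (_ , q) → path-injective (List.∷-injectiveʳ (trans (sym p) q)) }
    ; root-orphan   = λ ()
    ; ancestry      = λ { (node xs v) → climb xs v }
    }
    where
    climb : ∀ xs → .(v : Valid xs) → Star (Pᴬ unfolded) (node xs v) (node [] tt)
    climb []       _ = ε
    climb (x ∷ xs) v = (x , refl) ◅ climb xs (proj₂ v)

  child : ∀ (p : Node) {x} → Pᴬ T x (label p) → Node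
  child (node xs v) {x} e = node (x ∷ xs) (e , v)

  path-child : ∀ p {x} (e : Pᴬ T x (label p)) → path (child p e) ≡ x ∷ path p
  path-child (node xs v) e = refl

  child-vertex : ∀ {a p x} → path a ≡ x ∷ path p → Pᴬ T x (label p)
  child-vertex {node _ v} refl = recompute em (proj₁ v)

  label-child : ∀ {a p x} → path a ≡ x ∷ path p → label a ≡ rep x
  label-child e = cong endpoint e

  Corresponds : Node → List Node → List V → Set
  Corresponds p = ListPointwise.Pointwise (λ a x → path a ≡ x ∷ path p)

  ∈-corresponds→ : ∀ p a {E F x} → Corresponds p E F → path a ≡ x ∷ path p → a ∈ E → x ∈ F
  ∈-corresponds→ p a (e ∷ es) eq (here refl) = here (List.∷-injectiveˡ (trans (sym eq) e))
  ∈-corresponds→ p a (e ∷ es) eq (there i)   = there (∈-corresponds→ p a es eq i)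

  ∈-corresponds← : ∀ p a {E F x} → Corresponds p E F → path a ≡ x ∷ path p → x ∈ F → a ∈ E
  ∈-corresponds← p a (e ∷ es) eq (here refl) = here (path-injective (trans eq (sym e)))
  ∈-corresponds← p a (e ∷ es) eq (there i)   = there (∈-corresponds← p a es eq i)

  private A = unfolded

  -- Cut-off children are carried along because a move leaves such states behind, and the induction
  -- hypothesis is applied to them.
  Similar : Ordinal.Elt ω → Set
  Similar b = ∀ p {E F} → Corresponds p E F →
    below T A b (label p , F) (p , E) × below A T b (p , E) (label p , F)

  -- Below top, moves in the unfolding are translated from the leaves upwards:
  -- a vertex and its representative are interchangeable at level top, so each
  -- replacement of one by the other leaves the level c intact.
  module Translate {c} (c<top : c < top) (similar : Similar c) where

    to-tree : ∀ l {p E F} → Corresponds p E F → Legal A l (p , E) →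
      Σ[ l′ ∈ Move V ] Legal T l′ (label p , F) × Matched (below A T c) l (p , E) l′ (label p , F)
    to-tree stop corr _ = stop , tt , proj₂ (similar _ corr)
    to-tree (grow a l m) {p} corr ((x , e) , a∉ , L , M) =
      let l₁ , L₁ , i  = to-tree l [] L
          -- `l₁` is a move at `rep x`, the label of `a`, but the child of `label p` is `x`.
          l₂ , L₂ , i′ = respond {T} {T} (proj₂ (subst (_∼ᵀ x) (sym (label-child {a} {p} e)) (rep-∼ x))) c<top l₁ L₁
          m₁ , M₁ , j  = to-tree m (e ∷ corr) M
      in grow x l₂ m₁
       , (child-vertex {a} {p} e , (λ i → a∉ (∈-corresponds← p a corr e i)) , L₂ , M₁)
       , Matched-below-trans {A} {T} {T} l l₁ l₂ i i′ , j

    -- The recursion follows the reference move `l`, since `l₁` is replaced by answers `l₂` of the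
    -- same shape that are not parts of it.
    from-tree : ∀ l {s} l₁ {p E F} → Corresponds p E F → Legal T l₁ (label p , F) →
      Matched (below T T c) l s l₁ (label p , F) →
      Σ[ l′ ∈ Move Node ] Legal A l′ (p , E) × Matched (below T A c) l s l′ (p , E)
    from-tree stop stop corr _ h = stop , tt , below-trans {T} {T} {A} h (proj₁ (similar _ corr))
    from-tree (grow y l m) (grow x l₁ m₁) {p} corr (xp , x∉ , L₁ , M₁) (i , j) =
      let a            = child p xp
          e            = path-child p xp
          l₂ , L₂ , i′ = respond {T} {T} (proj₁ (subst (_∼ᵀ x) (sym (label-child {a} {p} e)) (rep-∼ x))) c<top l₁ L₁
          l₃ , L₃ , k  = from-tree l l₂ {a} [] L₂ (Matched-below-trans {T} {T} {T} l l₁ l₂ i i′)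
          m₃ , M₃ , k′ = from-tree m m₁ (e ∷ corr) M₁ j
      in grow a l₃ m₃ , ((x , e) , (λ i → x∉ (∈-corresponds→ p a corr e i)) , L₃ , M₃) , k , k′

  similar : Similar top
  similar = go (wellFounded top) λ c<top → c<top
    where
    go : ∀ {b} → Acc _<_ b → (∀ {c} → c < b → c < top) → Similar b
    go (acc rs) b≤top p corr =
        from-responses {T} {A} (λ c<b l L → to-tree (b≤top c<b) (ih c<b) l corr L)
      , from-responses {A} {T} (λ c<b l L →
          from-tree (b≤top c<b) (ih c<b) l l corr L (Matched-refl (below-refl {T}) l))
      where
      open Translate
      ih : ∀ {c} → c < _ → Similar c
      ih c<b = go (rs c<b) λ d<c → b≤top (<-trans d<c c<b)

  below-unfolded : below T A top (rootᴬ T , []) (rootᴬ A , [])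
  below-unfolded = below-trans {T} {T} {A} (proj₂ (rep-∼ (rootᴬ T))) (proj₁ (similar (rootᴬ A) []))

  infix 4 _∼ᴬ_
  _∼ᴬ_ : Node → Node → Set
  a ∼ᴬ b = below A A top (a , []) (b , []) × below A A top (b , []) (a , [])

  -- `similar` transfers equivalence of nodes to their labels, and equivalent representatives
  -- coincide. The classes of nodes are thereby indexed by vertices of `T`.
  ∼⇔label : ∀ {a b} → a ∼ᴬ b ⇔ (label a ≡ label b)
  ∼⇔label {a} {b} = mk⇔
    (λ (p , q) → trans (sym (rep-label a)) (trans (rep-cong (up p , up q)) (rep-label b)))
    (λ e → down e , down (sym e))
    where
    up : ∀ {a b} → below A A top (a , []) (b , []) → below T T top (label a , []) (label b , [])
    up {a} {b} p =
      below-trans {T} {A} {T} (proj₁ (similar a [])) (below-trans {A} {A} {T} p (proj₂ (similar b [])))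

    down : ∀ {a b} → label a ≡ label b → below A A top (a , []) (b , [])
    down {a} {b} e = below-trans {A} {T} {A} (proj₂ (similar a []))
      (subst (λ x → below T A top (x , []) (b , [])) (sym e) (proj₁ (similar b [])))

  Labelled : V → StatePred → Set
  Labelled d Q = ∀ a → Q A (a , []) ⇔ (label a ≡ d)

  -- Nodes with equal labels have children over the very same vertices of `T`. The children used up
  -- on both sides are kept in step through one list `F`.
  homogeneous : ∀ {d} (Q : StatePred) → Labelled d Q → ∀ k {a b} → label a ≡ label b →
                Many Q k A (a , []) → Many Q k A (b , [])
  homogeneous {d} Q labelled k eq = go k eq [] []
    where
    go : ∀ k {a b E E′ F} → label a ≡ label b → Corresponds a E F → Corresponds b E′ F →
         Many Q k A (a , E) → Many Q k A (b , E′)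
    go zero    _  _    _     _ = tt
    go (suc k) {a} {b} eq corr corr′ (z , (x , e) , z∉ , q , more) =
      z′ , (x , e′) , (λ i → z∉ (∈-corresponds← a z corr e (∈-corresponds→ b z′ corr′ e′ i)))
      , from (labelled z′) (trans (label-child {z′} {b} e′) (trans (sym (label-child {z} {a} e)) (to (labelled z) q)))
      , go k eq (e ∷ corr) (e′ ∷ corr′) more
      where
      xb : Pᴬ T x (label b)
      xb = subst (Pᴬ T x) eq (child-vertex {z} {a} e)
      z′ = child b xb
      e′ = path-child b xb

-- Isomorphisms from equal numbers of children

module Ranks (em : Classical) {V : Set} (countable : Countable V) (X : V → Set) where

  Has : ℕ → Set
  Has n = ∃[ x ] X x × code countable x ≡ n

  count : ℕ → ℕ
  count zero    = zero
  count (suc n) with em {P = Has n}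
  ... | yes _ = suc (count n)
  ... | no _  = count n

  -- On `X` the ranks fill an initial segment of ℕ, whether `X` is finite or infinite, so matching
  -- by rank treats all multiplicities alike.
  rank : V → ℕ
  rank x = count (code countable x)

  count-mono : ∀ {m} n → m ≤ⁿ n → count m ≤ⁿ count n
  count-mono zero    z≤n = ≤-refl
  count-mono (suc n) m≤1+n with m≤n⇒m<n∨m≡n m≤1+n
  ... | inj₂ refl = ≤-refl
  ... | inj₁ m<1+n with em {P = Has n}
  ...   | yes _ = m≤n⇒m≤1+n (count-mono n (s≤s⁻¹ m<1+n))
  ...   | no _  = count-mono n (s≤s⁻¹ m<1+n)

  count-suc : ∀ {x} → X x → count (suc (code countable x)) ≡ suc (rank x)
  count-suc {x} Xx with em {P = Has (code countable x)}
  ... | yes _  = refl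
  ... | no ¬h = contradiction (x , Xx , refl) ¬h

  rank-mono : ∀ {x y} → X x → code countable x <ⁿ code countable y → rank x <ⁿ rank y
  rank-mono {x} {y} Xx lt = ≤-trans (≤-reflexive (sym (count-suc Xx))) (count-mono (code countable y) lt)

  rank-injective : ∀ {x y} → X x → X y → rank x ≡ rank y → x ≡ y
  rank-injective {x} {y} Xx Xy e with <-cmp (code countable x) (code countable y)
  ... | tri< lt _ _ = contradiction e (<⇒≢ (rank-mono Xx lt))
  ... | tri≈ _ eq _ = code-injective countable eq
  ... | tri> _ _ gt = contradiction (sym e) (<⇒≢ (rank-mono Xy gt))

  rank-attained : ∀ n {k} → k <ⁿ count n → ∃[ x ] X x × rank x ≡ k
  rank-attained (suc n) k< with em {P = Has n}
  ... | no _  = rank-attained n k<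
  ... | yes (x , Xx , e) with m≤n⇒m<n∨m≡n (s≤s⁻¹ k<)
  ...   | inj₁ k<n  = rank-attained n k<n
  ...   | inj₂ refl = x , Xx , cong count e

module Isomorphisms (em : Classical) where
  open Choice em
  open Separation em

  module Children (S : Structure) (Q : StatePred) (p : Carrier S) where

    Child : Carrier S → Set
    Child z = Pᴬ S z p × Q S (z , [])

    open Ranks em (Structure.countable S) Child public

    private
      codeˢ : Carrier S → ℕ
      codeˢ = code (Structure.countable S)

    -- Children are picked in order of decreasing code; `high` then keeps the excluded ones apart
    -- from those still available.
    count⇒many : ∀ n k {E} → k ≤ⁿ count n → (∀ {e} → e ∈ E → n ≤ⁿ codeˢ e) → Many Q k S (p , E)
    count⇒many n       zero    _   _    = tt
    count⇒many (suc n) (suc k) k≤ high with em {P = Has n}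
    ... | no _  = count⇒many n (suc k) k≤ λ i → ≤-trans (m≤n⇒m≤1+n ≤-refl) (high i)
    ... | yes (x , (xp , q) , e) =
      x , xp , (λ i → 1+n≰n (≤-trans (high i) (≤-reflexive e))) , q ,
      count⇒many n k (s≤s⁻¹ k≤) λ { (here refl) → ≤-reflexive (sym e) ; (there i) → ≤-trans (m≤n⇒m≤1+n ≤-refl) (high i) }

    many⇒injection : ∀ k {E} → Many Q k S (p , E) →
      Σ[ f ∈ (Fin k → Carrier S) ] (∀ i → Child (f i)) × (∀ i → f i ∉ E) × (∀ {i j} → f i ≡ f j → i ≡ j)
    many⇒injection zero    _ = (λ ()) , (λ ()) , (λ ()) , λ { {()} }
    many⇒injection (suc k) {E} (z , zp , z∉ , q , more) with many⇒injection k more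
    ... | f , child , f∉ , inj =
      g , (λ { zero → zp , q ; (suc i) → child i })
        , (λ { zero → z∉ ; (suc i) e → f∉ i (there e) })
        , λ {i} {j} → g-injective i j
      where
      g : Fin (suc k) → Carrier S
      g zero    = z
      g (suc i) = f i

      g-injective : ∀ i j → g i ≡ g j → i ≡ j
      g-injective zero    zero    _ = refl
      g-injective zero    (suc j) e = contradiction (here (sym e)) (f∉ j)
      g-injective (suc i) zero    e = contradiction (here e) (f∉ i)
      g-injective (suc i) (suc j) e = cong suc (inj e)

    many⇒≤ : ∀ {j} k → Many Q k S (p , []) → (∀ {z} → Child z → rank z <ⁿ j) → k ≤ⁿ j
    many⇒≤ k many bounded with f , child , _ , inj ← many⇒injection k many =
      injective⇒≤ {f = λ i → fromℕ< (bounded (child i))} λ {i} {i′} e →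
        inj (rank-injective (child i) (child i′) (fromℕ<-injective _ _ _ _ e))

    rank⇒many : ∀ {z} → Child z → Many Q (suc (rank z)) S (p , [])
    rank⇒many {z} child = count⇒many (suc (codeˢ z)) _ (≤-reflexive (sym (count-suc child))) λ ()

    -- Ranks leave no gaps. Were `k` not attained, all ranks would be below `k`, too few for `suc k`
    -- distinct children.
    many⇒rank : ∀ k → Many Q (suc k) S (p , []) → ∃[ z ] Child z × rank z ≡ k
    many⇒rank k many = dne λ none → 1+n≰n (many⇒≤ (suc k) many λ child → ≰⇒> λ k≤ →
      none (rank-attained _ (≤-trans (s≤s k≤) (≤-reflexive (sym (count-suc child))))))

  module _ {C : Set} (δ : C → StatePred) (c₀ : C) where

    record Coloured (S : Structure) : Set where
      field
        rooted   : Rooted S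
        root-col : δ c₀ S (rootᴬ S , [])
        colour   : ∀ x → ∃[ c ] δ c S (x , [])
        disjoint : ∀ {x c d} → δ c S (x , []) → δ d S (x , []) → c ≡ d

    open Coloured

    -- This one-sided condition makes the matching total on `A`; the two directions come from
    -- different conjuncts of the Scott sentence.
    Dominates : Structure → Structure → Set
    Dominates A B = ∀ {c a b} → δ c A (a , []) → δ c B (b , []) →
                    ∀ d k → Many (δ d) k A (a , []) → Many (δ d) k B (b , [])

    -- Children of matched nodes are matched when they have the same colour and
    -- the same rank among the siblings of that colour.
    data Match (A B : Structure) : Carrier A → Carrier B → Set where
      root : Match A B (rootᴬ A) (rootᴬ B)
      step : ∀ {p q} d {a b} → Match A B p q →
             Children.Child A (δ d) p a → Children.Child B (δ d) q b →
             Children.rank A (δ d) p a ≡ Children.rank B (δ d) q b → Match A B a b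

    Match-sym : ∀ {A B a b} → Match A B a b → Match B A b a
    Match-sym root             = root
    Match-sym (step d m x y e) = step d (Match-sym m) y x (sym e)

    module _ {A B : Structure} (colᴬ : Coloured A) (colᴮ : Coloured B) where

      Match-colour : ∀ {a b} → Match A B a b → ∃[ c ] δ c A (a , []) × δ c B (b , [])
      Match-colour root                           = c₀ , root-col colᴬ , root-col colᴮ
      Match-colour (step d _ (_ , q) (_ , q′) _) = d , q , q′

      Match-total : Dominates A B → ∀ a → ∃[ b ] Match A B a b
      Match-total dom a = go (ancestry (rooted colᴬ) a)
        where
        go : ∀ {a} → Star (Pᴬ A) a (rootᴬ A) → ∃[ b ] Match A B a b
        go ε = rootᴬ B , root
        go {a} (_◅_ {j = p} ap s)
          with q , m ← go s
          with c , cp , cq ← Match-colour m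
          with d , da ← colour colᴬ a
          with b , child , e ← Children.many⇒rank B (δ d) q _
                 (dom cp cq d (suc (Children.rank A (δ d) p a)) (Children.rank⇒many A (δ d) p (ap , da)))
          = b , step d m (ap , da) child (sym e)

      Match-functional : ∀ {a b b′} → Match A B a b → Match A B a b′ → b ≡ b′
      Match-functional root root = refl
      Match-functional root (step _ _ (p , _) _ _) = contradiction p (root-orphan (rooted colᴬ))
      Match-functional (step _ _ (p , _) _ _) root = contradiction p (root-orphan (rooted colᴬ))
      Match-functional (step d {a} m (p , q) child e) (step d′ m′ (p′ , q′) child′ e′)
        with refl ← parent-unique (rooted colᴬ) p p′ | refl ← disjoint colᴬ q q′
        with refl ← Match-functional m m′ =
        Children.rank-injective B (δ d) _ child child′ (trans (sym e) e′)

      Match-P : ∀ {a a′ b b′} → Match A B a b → Match A B a′ b′ → Pᴬ A a a′ → Pᴬ B b b′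
      Match-P root _ p = contradiction p (root-orphan (rooted colᴬ))
      Match-P (step d m (p′ , _) (q , _) _) m′ p with refl ← parent-unique (rooted colᴬ) p p′ =
        subst (Pᴬ B _) (Match-functional m m′) q

    Dominates⇒≅ : ∀ {A B} → Coloured A → Coloured B → Dominates A B → Dominates B A → A ≅ B
    Dominates⇒≅ {A} {B} colᴬ colᴮ dom dom′ = record
      { bijection = mk↔ₛ′ f g
          (λ b → Match-functional colᴬ colᴮ (f-match (g b)) (Match-sym (g-match b)))
          (λ a → Match-functional colᴮ colᴬ (g-match (f a)) (Match-sym (f-match a)))
      ; root-pres = Match-functional colᴬ colᴮ (f-match (rootᴬ A)) root
      ; P-pres    = λ x y → mk⇔
          (Match-P colᴬ colᴮ (f-match x) (f-match y))
          (Match-P colᴮ colᴬ (Match-sym (f-match x)) (Match-sym (f-match y)))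
      }
      where
      f = λ a → proj₁ (Match-total colᴬ colᴮ dom a)
      g = λ b → proj₁ (Match-total colᴮ colᴬ dom′ b)
      f-match = λ a → proj₂ (Match-total colᴬ colᴮ dom a)
      g-match = λ b → proj₂ (Match-total colᴮ colᴬ dom′ b)

-- Isomorphism invariance of satisfaction

module IsomorphismInvariance {A B : Structure} (e : A ≅ B) where
  open _≅_ e using (bijection; root-pres; P-pres)
  open Inverse bijection using (strictlyInverseˡ; strictlyInverseʳ) renaming (to to f; from to g)

  f-injective : ∀ {x y} → f x ≡ f y → x ≡ y
  f-injective {x} {y} eq = trans (sym (strictlyInverseʳ x)) (trans (cong g eq) (strictlyInverseʳ y))

  ⟦⟧-iso : ∀ {n} (t : Term n) ρ → ⟦ B ⟧ t (Vec.map f ρ) ≡ f (⟦ A ⟧ t ρ)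
  ⟦⟧-iso (var i) ρ = lookup-map i f ρ
  ⟦⟧-iso r       ρ = sym root-pres

  sat-iso : ∀ {n} (φ : Formula n) ρ → Sat A φ ρ ⇔ Sat B φ (Vec.map f ρ)
  sat-iso (s ≐ t) ρ rewrite ⟦⟧-iso s ρ | ⟦⟧-iso t ρ = mk⇔ (cong f) f-injective
  sat-iso (P s t) ρ rewrite ⟦⟧-iso s ρ | ⟦⟧-iso t ρ = P-pres _ _
  sat-iso (¬̇ φ)   ρ = mk⇔ (λ ¬s s → ¬s (from (sat-iso φ ρ) s)) (λ ¬s s → ¬s (to (sat-iso φ ρ) s))
  sat-iso (φ ∧̇ ψ) ρ = mk⇔
    (λ (p , q) → to (sat-iso φ ρ) p , to (sat-iso ψ ρ) q)
    (λ (p , q) → from (sat-iso φ ρ) p , from (sat-iso ψ ρ) q)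
  sat-iso (φ ∨̇ ψ) ρ = mk⇔
    (Sum.map (to (sat-iso φ ρ)) (to (sat-iso ψ ρ))) (Sum.map (from (sat-iso φ ρ)) (from (sat-iso ψ ρ)))
  sat-iso (⋀ c φ) ρ = mk⇔ (λ s i → to (sat-iso (φ i) ρ) (s i)) (λ s i → from (sat-iso (φ i) ρ) (s i))
  sat-iso (⋁ c φ) ρ = mk⇔ (λ (i , s) → i , to (sat-iso (φ i) ρ) s) (λ (i , s) → i , from (sat-iso (φ i) ρ) s)
  sat-iso (∀̇ φ)   ρ = mk⇔
    (λ s b → subst (λ b → Sat B φ (b ∷ Vec.map f ρ)) (strictlyInverseˡ b) (to (sat-iso φ (g b ∷ ρ)) (s (g b))))
    (λ s a → from (sat-iso φ (a ∷ ρ)) (s (f a)))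
  sat-iso (∃̇ φ)   ρ = mk⇔
    (λ (a , s) → f a , to (sat-iso φ (a ∷ ρ)) s)
    (λ (b , s) → g b , from (sat-iso φ (g b ∷ ρ))
      (subst (λ b → Sat B φ (b ∷ Vec.map f ρ)) (sym (strictlyInverseˡ b)) s))

-- The Scott sentence

module ScottSentence (em : Classical) (β : Ordinal) (A : Structure) (rootedᴬ : Rooted A)
  {C : Set} (C-countable : Countable C) (label : Carrier A → C)
  (δ : C → StatePred) (δ-definable : ∀ c → DefinableState β (δ c))
  (δ-spec : ∀ c a → δ c A (a , []) ⇔ (label a ≡ c))
  (homogeneous : ∀ d k {a b} → label a ≡ label b →
    Separation.Many em (δ d) k A (a , []) → Separation.Many em (δ d) k A (b , [])) where

  open Choice em
  open Calculus em
  open Separation em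
  open Isomorphisms em

  private
    β₁ β₂ : Ordinal
    β₁ = osuc β
    β₂ = osuc β₁

    β≺β₁ : β ≺ β₁
    β≺β₁ = ≺-osuc β

    β₁≺β₂ : β₁ ≺ β₂
    β₁≺β₂ = ≺-osuc β₁

    pos₁ : IsPositive β₁
    pos₁ = _≺_.bound β≺β₁

    pos₂ : IsPositive β₂
    pos₂ = _≺_.bound β₁≺β₂

    c₀ : C
    c₀ = label (rootᴬ A)

  Ancestry : ∀ {n} → ℕ → Fin n → Pred n
  Ancestry zero    z B ρ = lookup ρ z ≡ rootᴬ B
  Ancestry (suc n) z     = ∃ᵖ (sat (P (var (suc z)) (var zero)) ∩ Ancestry n zero)

  Ancestry-definable : ∀ m {n} (z : Fin n) → ∃Definable β (Ancestry m z)
  Ancestry-definable zero    z = matrix (Definable-quantifierFree (var z ≐ r))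
  Ancestry-definable (suc m) z = ex
    (∃Definable-∩ (matrix (Definable-quantifierFree (P (var (suc z)) (var zero)))) (Ancestry-definable m zero))
    λ B ρ → ⇔.refl

  Ancestry⇔Star : ∀ {B n} (z : Fin n) ρ → (∃[ m ] Ancestry m z B ρ) ⇔ Star (Pᴬ B) (lookup ρ z) (rootᴬ B)
  Ancestry⇔Star {B} z ρ = mk⇔ (λ (m , a) → star m z ρ a) (λ s → ancestors z ρ s)
    where
    star : ∀ m {n} (z : Fin n) ρ → Ancestry m z B ρ → Star (Pᴬ B) (lookup ρ z) (rootᴬ B)
    star zero    z ρ e           = subst (Star (Pᴬ B) _) e ε
    star (suc m) z ρ (a , p , s) = p ◅ star m zero (a ∷ ρ) s

    ancestors : ∀ {n} (z : Fin n) ρ → Star (Pᴬ B) (lookup ρ z) (rootᴬ B) → ∃[ m ] Ancestry m z B ρ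
    ancestors z ρ s = go s refl
      where
      go : ∀ {x n} → Star (Pᴬ B) x (rootᴬ B) → ∀ {z : Fin n} {ρ} → lookup ρ z ≡ x → ∃[ m ] Ancestry m z B ρ
      go ε       e    = zero , e
      go (p ◅ s) refl = let m , a = go s refl in suc m , _ , p , a

  at : ∀ {n} → StatePred → Fin n → Pred n
  at X z = atVars X z []

  distinctParents : Formula 3
  distinctParents =
    P (var zero) (var (suc zero)) ∧̇ P (var zero) (var (suc (suc zero))) ∧̇ ¬̇ (var (suc zero) ≐ var (suc (suc zero)))

  -- Disjunctions and implications are written with `∼`, `∩` and `⋂`, the operations whose levels
  -- the calculus tracks. State predicates are evaluated at variables, so the root is reached
  -- through a variable equal to `r`.
  UniqueParent Orphan Connected RootColour Colour Disjoint : Pred 0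
  UniqueParent = ∀ᵖ (∀ᵖ (∀ᵖ (sat (¬̇ distinctParents))))
  Orphan       = ∀ᵖ (sat (¬̇ P r (var zero)))
  Connected    = ∀ᵖ (∼ ⋂ λ m → ∼ Ancestry m zero)
  RootColour   = ∀ᵖ (∼ (sat (var zero ≐ r) ∩ ∼ at (δ c₀) zero))
  Colour       = ∀ᵖ (∼ ⋂ λ c → ∼ at (δ c) zero)
  Disjoint     = ⋂ λ ((c , d) : C × C) B ρ → c ≢ d → (∀ᵖ (∼ (at (δ c) zero ∩ at (δ d) zero))) B ρ

  -- By homogeneity at least one of the two is true of each triple. A colour that no node of `A` has
  -- makes both true, and the two resulting conjuncts exclude it from every model.
  AllMany NoneMany : C × C × ℕ → Set
  AllMany  (c , d , k) = ∀ a → label a ≡ c → Many (δ d) k A (a , [])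
  NoneMany (c , d , k) = ∀ a → label a ≡ c → ¬ Many (δ d) k A (a , [])

  AtLeast LessThan : Pred 0
  AtLeast  = ⋂ λ ((c , d , k) : C × C × ℕ) B ρ → AllMany (c , d , k) →
    (∀ᵖ (∼ (at (δ c) zero ∩ ∼ at (Many (δ d) k) zero))) B ρ
  LessThan = ⋂ λ ((c , d , k) : C × C × ℕ) B ρ → NoneMany (c , d , k) →
    (∀ᵖ (∼ (at (δ c) zero ∩ at (Many (δ d) k) zero))) B ρ

  Theory : Pred 0
  Theory = UniqueParent ∩ Orphan ∩ Connected ∩ RootColour ∩ Colour ∩ Disjoint ∩ AtLeast ∩ LessThan

  ℕ-countable : Countable ℕ
  ℕ-countable = mk↣ {to = id} id

  UniqueParent-definable : Definable β₂ UniqueParent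
  UniqueParent-definable = Definable-∀ pos₂ (Definable-∀ pos₂ (Definable-∀ pos₂
    (Definable-quantifierFree {φ = ¬̇ distinctParents} (¬̇ (P _ _ ∧̇ P _ _ ∧̇ ¬̇ (_ ≐ _))))))

  Orphan-definable : Definable β₂ Orphan
  Orphan-definable = Definable-∀ pos₂
    (Definable-quantifierFree (¬̇ P r (var zero)))

  Connected-definable : Definable β₂ Connected
  Connected-definable = Definable-∀ pos₂ (Definable-∼ β₁≺β₂
    (Definable-⋂ pos₁ ℕ-countable λ m → Definable-∼∃ β≺β₁ (Ancestry-definable m zero)))

  RootColour-definable : Definable β₂ RootColour
  RootColour-definable = Definable-∀ pos₂ (Definable-∼ β₁≺β₂
    (Definable-∩ (Definable-quantifierFree (var zero ≐ r)) (Definable-∼ β≺β₁ (δ-definable c₀ zero []))))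

  Colour-definable : Definable β₂ Colour
  Colour-definable = Definable-∀ pos₂ (Definable-∼ β₁≺β₂
    (Definable-⋂ pos₁ C-countable λ c → Definable-∼ β≺β₁ (δ-definable c zero [])))

  Disjoint-definable : Definable β₂ Disjoint
  Disjoint-definable = Definable-⋂ pos₂ (×-countable C-countable C-countable) λ (c , d) →
    Definable-guard _ λ _ → Definable-∀ pos₂ (Definable-mono β₁≺β₂ (Definable-∼ β≺β₁
      (Definable-∩ (δ-definable c zero []) (δ-definable d zero []))))

  CCℕ-countable : Countable (C × C × ℕ)
  CCℕ-countable = ×-countable C-countable (×-countable C-countable ℕ-countable)

  AtLeast-definable : Definable β₂ AtLeast
  AtLeast-definable = Definable-⋂ pos₂ CCℕ-countable λ (c , d , k) →
    Definable-guard _ λ _ → Definable-∀ pos₂ (Definable-∼ β₁≺β₂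
      (Definable-∩ (Definable-mono β≺β₁ (δ-definable c zero []))
        (Definable-∼∃ β≺β₁ (Many-definable (δ d) (δ-definable d) k zero []))))

  LessThan-definable : Definable β₂ LessThan
  LessThan-definable = Definable-⋂ pos₂ CCℕ-countable λ (c , d , k) →
    Definable-guard _ λ _ → Definable-∀ pos₂ (Definable-mono β₁≺β₂ (Definable-∼∃ β≺β₁
      (∃Definable-∩ (matrix (δ-definable c zero [])) (Many-definable (δ d) (δ-definable d) k zero []))))

  Theory-definable : Definable β₂ Theory
  Theory-definable =
    Definable-∩ UniqueParent-definable (Definable-∩ Orphan-definable (Definable-∩ Connected-definable
    (Definable-∩ RootColour-definable (Definable-∩ Colour-definable (Definable-∩ Disjoint-definable
    (Definable-∩ AtLeast-definable LessThan-definable))))))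

  theory-A : Theory A []
  theory-A =
      (λ z y x (p , q , ne) → ne (parent-unique rootedᴬ p q))
    , (λ y → root-orphan rootedᴬ)
    , (λ x none → let m , a = from (Ancestry⇔Star zero (x ∷ [])) (ancestry rootedᴬ x) in none m a)
    , (λ { x (refl , ¬δ) → ¬δ (from (δ-spec c₀ x) refl) })
    , (λ x none → none (label x) (from (δ-spec _ x) refl))
    , (λ (c , d) c≢d x (p , q) → c≢d (trans (sym (to (δ-spec c x) p)) (to (δ-spec d x) q)))
    , (λ (c , d , k) all x (p , ¬many) → ¬many (all x (to (δ-spec c x) p)))
    , (λ (c , d , k) none x (p , many) → none x (to (δ-spec c x) p) many)

  theory⇒coloured : ∀ {B} → Theory B [] → Coloured δ c₀ B
  theory⇒coloured {B} (unique , orphan , connected , root-colour , colour , disjoint , _) = record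
    { rooted   = record
      { parent-unique = λ p q → dne λ ne → unique _ _ _ (p , q , ne)
      ; root-orphan   = orphan _
      ; ancestry      = λ x → to (Ancestry⇔Star zero (x ∷ [])) (dne λ none → connected x λ m a → none (m , a))
      }
    ; root-col = dne λ ¬δ → root-colour _ (refl , ¬δ)
    ; colour   = λ x → dne λ none → colour x λ c p → none (c , p)
    ; disjoint = λ p q → dne λ ne → disjoint (_ , _) ne _ (p , q)
    }

  theory⇒dominates : ∀ {B} → Theory B [] → Dominates δ c₀ A B
  theory⇒dominates (_ , _ , _ , _ , _ , _ , at-least , _) {c} {a} {b} p q d k many =
    dne λ ¬many → at-least (c , d , k)
      (λ a′ e → homogeneous d k (trans (to (δ-spec c a) p) (sym e)) many) b (q , ¬many)

  -- If `a` lacked the children, homogeneity would make `NoneMany` true and `less-than` would forbid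
  -- them at `b`.
  theory⇒dominated : ∀ {B} → Theory B [] → Dominates δ c₀ B A
  theory⇒dominated (_ , _ , _ , _ , _ , _ , _ , less-than) {c} {b} {a} q p d k many =
    dne λ ¬many → less-than (c , d , k)
      (λ a′ e many′ → ¬many (homogeneous d k (trans e (sym (to (δ-spec c a) p))) many′)) b (q , many)

  hasScottSentence : HasΠScottSentence β₂ A
  hasScottSentence = formula , isΠ , λ B → mk⇔
    (λ s → let t = to (spec B []) s in
      Dominates⇒≅ δ c₀ (theory⇒coloured t) (theory⇒coloured theory-A) (theory⇒dominated t) (theory⇒dominates t))
    (λ e → from (IsomorphismInvariance.sat-iso e formula []) (from (spec A []) theory-A))
    where open Definable Theory-definable

-- Scott ranks

-- The same ordinal has many presentations, so membership in a Π level has to be transported between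
-- them.
record OrderIso (α β : Ordinal) : Set where
  field
    embed      : Ordinal.Elt α → Ordinal.Elt β
    mono       : ∀ {x y} → Ordinal._<_ α x y → Ordinal._<_ β (embed x) (embed y)
    surjective : ∀ y → ∃[ x ] embed x ≡ y

osuc-iso : ∀ {α β} → OrderIso α β → OrderIso (osuc α) (osuc β)
osuc-iso i = record
  { embed      = Maybe.map embed
  ; mono       = λ { [ p ] → [ mono p ] ; [ x ]<⊤⁺ → [ embed x ]<⊤⁺ }
  ; surjective = λ { nothing → nothing , refl ; (just y) → let x , e = surjective y in just x , cong just e }
  }
  where open OrderIso i

≺-iso : ∀ {α β γ} → γ ≺ α → OrderIso α β → γ ≺ β
≺-iso {α} {β} γ≺α i = record
  { bound = embed p.bound
  ; embed = λ x → embed (p.embed x)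
  ; mono  = λ x<y → mono (p.mono x<y)
  ; image = mk⇔ image→ λ { (x , refl) → mono (from p.image (x , refl)) }
  }
  where
  module p = _≺_ γ≺α
  open OrderIso i
  image→ : ∀ {b} → Ordinal._<_ β b (embed p.bound) → ∃[ x ] embed (p.embed x) ≡ b
  image→ {b} lt with y , refl ← surjective b
    with x , refl ← to p.image (Monotone.reflect α β embed mono lt) = x , refl

≺⇒iso-seg : ∀ {α β} (p : α ≺ β) → OrderIso α (OrdinalProperties.seg β (_≺_.bound p))
≺⇒iso-seg {β = β} p = record
  { embed      = λ x → embed x ∣ from image (x , refl)
  ; mono       = mono
  ; surjective = λ y → let x , e = to image (elt<bound y) in x , elt-injective e
  }
  where
  open _≺_ p
  open OrdinalProperties β using (_∣_; elt<bound; elt-injective)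

∀Σ-iso : ∀ {α β n} {φ : Formula n} → OrderIso α β → Is∀Σ< α φ → Is∀Σ< β φ
∀Σ-iso i (matrix γ≺α s) = matrix (≺-iso γ≺α i) s
∀Σ-iso i (∀̇ s)          = ∀̇ ∀Σ-iso i s

Π-osuc-iso : ∀ {α β n} {φ : Formula n} → OrderIso α β → IsΠ (osuc α) φ → IsΠ (osuc β) φ
Π-osuc-iso i (base z _) = contradiction nothing z
Π-osuc-iso i (⋀ c _ f)     = ⋀ c nothing λ j → ∀Σ-iso (osuc-iso i) (f j)

-- Comparability of well-orders

module Comparison (em : Classical) (α β : Ordinal) where
  open Choice em
  private
    module α = OrdinalProperties α
    module β = OrdinalProperties β

  -- A bisimulation between the elements below `x` and those below `y`; on well-orders it means that
  -- the two initial segments are isomorphic.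
  data SameRank (x : α.Elt) (y : β.Elt) : Set where
    same : (∀ {x′} → x′ α.< x → ∃[ y′ ] y′ β.< y × SameRank x′ y′) →
           (∀ {y′} → y′ β.< y → ∃[ x′ ] x′ α.< x × SameRank x′ y′) → SameRank x y

  down : ∀ {x y x′} → SameRank x y → x′ α.< x → ∃[ y′ ] y′ β.< y × SameRank x′ y′
  down (same f _) = f

  down′ : ∀ {x y y′} → SameRank x y → y′ β.< y → ∃[ x′ ] x′ α.< x × SameRank x′ y′
  down′ (same _ g) = g

  functional : ∀ {x y y′} → SameRank x y → SameRank x y′ → y ≡ y′
  functional {x} = go (α.wellFounded x)
    where
    mutual
      go : ∀ {x} → Acc α._<_ x → ∀ {y y′} → SameRank x y → SameRank x y′ → y ≡ y′
      go a {y} {y′} s s′ with β.compare y y′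
      ... | tri< lt _ _ = contradiction lt (not-below a s s′)
      ... | tri≈ _ e _  = e
      ... | tri> _ _ gt = contradiction gt (not-below a s′ s)

      not-below : ∀ {x} → Acc α._<_ x → ∀ {y y′} → SameRank x y → SameRank x y′ → ¬ y β.< y′
      not-below (acc rs) s s′ y<y′ with x′ , x′<x , t ← down′ s′ y<y′ with y″ , y″<y , t′ ← down s x′<x =
        β.irrefl (go (rs x′<x) t′ t) y″<y

  increasing : ∀ {x y x′ y′} → SameRank x y → SameRank x′ y′ → x′ α.< x → y′ β.< y
  increasing s s′ x′<x with y″ , y″<y , t ← down s x′<x with refl ← functional t s′ = y″<y

  injective : ∀ {x x′ y} → SameRank x y → SameRank x′ y → x ≡ x′
  injective {x} {x′} s s′ with α.compare x x′
  ... | tri< lt _ _ = contradiction (increasing s′ s lt) (β.irrefl refl)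
  ... | tri≈ _ e _  = e
  ... | tri> _ _ gt = contradiction (increasing s s′ gt) (β.irrefl refl)

  -- Let `x` be least without a partner. By induction every `y` has a partner below `x`: otherwise
  -- everything below `y` is matched below `x` and conversely, so `y` itself would be a partner of
  -- `x`.
  ≼-or-≻ : α ≼ β ⊎ β ≺ α
  ≼-or-≻ with em {P = ∀ x → ∃[ y ] SameRank x y}
  ... | yes total = inj₁ record
    { embed      = λ x → proj₁ (total x)
    ; mono       = λ x<y → increasing (proj₂ (total _)) (proj₂ (total _)) x<y
    ; downClosed = λ {x} b< → let x′ , _ , s = down′ (proj₂ (total x)) b< in
        x′ , functional (proj₂ (total x′)) s
    }
  ... | no ¬total with x , none , least ← wf-least α.wellFounded (λ x → ¬ (∃[ y ] SameRank x y)) (¬∀⇒∃¬ ¬total) = inj₂ record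
    { bound = x
    ; embed = λ y → proj₁ (partner y)
    ; mono  = mono′
    ; image = mk⇔
        (λ x′<x → let y , s = dne (least x′<x) in y , injective (proj₂ (proj₂ (partner y))) s)
        λ { (y , refl) → proj₁ (proj₂ (partner y)) }
    }
    where
    find : ∀ {y} → Acc β._<_ y → ∃[ x′ ] x′ α.< x × SameRank x′ y
    find {y} (acc rs) = dne λ missing → none (y , same (partner-below missing) (λ y′<y → find (rs y′<y)))
      where
      partner-below : ¬ (∃[ x′ ] x′ α.< x × SameRank x′ y) → ∀ {x′} → x′ α.< x → ∃[ y′ ] y′ β.< y × SameRank x′ y′
      partner-below missing {x′} x′<x with dne (least x′<x)
      ... | y′ , s with β.compare y′ y
      ...   | tri< lt _ _   = y′ , lt , s
      ...   | tri≈ _ refl _ = contradiction (x′ , x′<x , s) missing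
      ...   | tri> _ _ gt with x″ , x″<x′ , s″ ← down′ s gt =
        contradiction (x″ , α.<-trans x″<x′ x′<x , s″) missing

    partner : ∀ y → ∃[ x′ ] x′ α.< x × SameRank x′ y
    partner y = find (β.wellFounded y)

    mono′ : ∀ {y y′} → y β.< y′ → proj₁ (partner y) α.< proj₁ (partner y′)
    mono′ {y} {y′} y<y′ with x′ , x′< , s ← down′ (proj₂ (proj₂ (partner y′))) y<y′ =
      subst (α._< _) (injective s (proj₂ (proj₂ (partner y)))) x′<

module ScottRank (em : Classical) (A : Structure) where
  open Choice em

  HasΠ-seg : ∀ {β γ} (p : β ≺ γ) → HasΠScottSentence (osuc β) A →
             HasΠScottSentence (osuc (OrdinalProperties.seg γ (_≺_.bound p))) A
  HasΠ-seg p (θ , isΠ , scott) = θ , Π-osuc-iso (≺⇒iso-seg p) isΠ , scott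

  -- Up to isomorphism the ordinals below `γ` are its segments, so the least candidate is sought
  -- among these and `γ` itself.
  scottRankAtMost : ∀ γ → HasΠScottSentence (osuc γ) A → ScottRankAtMost γ A
  scottRankAtMost γ h with em {P = ∃[ c ] HasΠScottSentence (osuc (OrdinalProperties.seg γ c)) A}
  ... | no none = γ , (h , minimal) , record { embed = id ; mono = id ; downClosed = λ _ → _ , refl }
    where
    minimal : ∀ β → HasΠScottSentence (osuc β) A → γ ≼ β
    minimal β h′ with Comparison.≼-or-≻ em γ β
    ... | inj₁ γ≼β = γ≼β
    ... | inj₂ β≺γ = contradiction (_ , HasΠ-seg β≺γ h′) none
  ... | yes some with wf-least (Ordinal.wellFounded γ) _ some
  ...   | c , h′ , least = seg c , (h′ , minimal) , record
    { embed = elt ; mono = id ; downClosed = λ {x} b< → (_ ∣ <-trans b< (elt<bound x)) , refl }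
    where
    open OrdinalProperties γ
    minimal : ∀ β → HasΠScottSentence (osuc β) A → seg c ≼ β
    minimal β h″ with Comparison.≼-or-≻ em (seg c) β
    ... | inj₁ γ≼β = γ≼β
    ... | inj₂ β≺γ = contradiction (HasΠ-seg (≺-trans β≺γ (seg≺ c)) h″) (least (elt<bound (_≺_.bound β≺γ)))

≅-trans : ∀ {A B C} → A ≅ B → B ≅ C → A ≅ C
≅-trans {A} {B} {C} i j = record
  { bijection = _≅_.bijection j ↔-∘ _≅_.bijection i
  ; root-pres = trans (cong (_≅_.to j) (_≅_.root-pres i)) (_≅_.root-pres j)
  ; P-pres    = λ x y → ⇔.trans (_≅_.P-pres i x y) (_≅_.P-pres j _ _)
  }

HasΠScottSentence-≅ : ∀ {β A B} → A ≅ B → B ≅ A → HasΠScottSentence β A → HasΠScottSentence β B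
HasΠScottSentence-≅ i j (θ , isΠ , scott) = θ , isΠ , λ C → mk⇔
  (λ s → ≅-trans (to (scott C) s) i) (λ k → from (scott C) (≅-trans k j))

-- The model

module Colouring (em : Classical) (ω : Ordinal) (top : Ordinal.Elt ω) (T : Structure) (rootedᵀ : Rooted T) where
  open Choice em
  open Calculus em
  open Separation em
  open OrdinalProperties ω using (seg≺)
  open BackAndForth ω
  open Unfolding em ω top T rootedᵀ public

  -- The separator of `a` gives one direction only. For the other, `t` must fail the separator of
  -- every `b` not below `a`; since `t` satisfies its own separator, it is then below `a`.
  similarTo : Node → StatePred
  similarTo a B t = Separator.holds (separator unfolded ω top (a , [])) B t ×
    (∀ b → ¬ below unfolded unfolded top (b , []) (a , []) →
      ¬ Separator.holds (separator unfolded ω top (b , [])) B t)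

  similarTo-definable : ∀ a → DefinableState ω (similarTo a)
  similarTo-definable a z L = Definable-∩
    (Definable-mono (seg≺ top) (isDefinable (separator unfolded ω top (a , [])) z L))
    (Definable-⋂ top (Structure.countable unfolded) λ b → Definable-guard _ λ _ →
      Definable-∼ (seg≺ top) (isDefinable (separator unfolded ω top (b , [])) z L))
    where open Separator

  similarTo-spec : ∀ a b → similarTo a unfolded (b , []) ⇔ (a ∼ᴬ b)
  similarTo-spec a b = mk⇔
    (λ (p , q) → to (spec a (b , [])) p ,
      dne λ ¬below → q b ¬below (from (spec b (b , [])) (below-refl {unfolded})))
    (λ (p , q) → from (spec a (b , [])) p ,
      λ c ¬below h → ¬below (below-trans {unfolded} {unfolded} {unfolded} (to (spec c (b , [])) h) q))
    where spec = λ a → Separator.spec (separator unfolded ω top (a , []))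

  colour : Carrier T → StatePred
  colour c with em {P = ∃[ a ] label a ≡ c}
  ... | yes (a , _) = similarTo a
  ... | no _        = λ _ _ → ⊥

  colour-definable : ∀ c → DefinableState ω (colour c)
  colour-definable c z L with em {P = ∃[ a ] label a ≡ c}
  ... | yes (a , _) = similarTo-definable a z L
  ... | no _        = Definable-resp (λ B ρ → mk⇔ (λ f → f refl) λ ()) (Definable-quantifierFree (¬̇ (r ≐ r)))

  colour-spec : ∀ c b → colour c unfolded (b , []) ⇔ (label b ≡ c)
  colour-spec c b with em {P = ∃[ a ] label a ≡ c}
  ... | yes (a , refl) = ⇔.trans (similarTo-spec a b) (⇔.trans ∼⇔label (mk⇔ sym sym))
  ... | no none        = mk⇔ (λ ()) λ e → none (b , e)

module Model (em : Classical) (α : Ordinal) (T : Tree) where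
  open TreeProperties em
  -- The levels of `osuc α` run up to its top element `nothing`, whose segment is a copy of α;
  -- classes at level `nothing` are therefore the level-α classes.
  open Colouring em (osuc α) nothing (treeStructure T) (treeStructure-rooted T)
  open FromRooted rooted using (tree; isParent⇔) public

  unfolded≅tree : unfolded ≅ treeStructure tree
  unfolded≅tree = record { bijection = ↔-id _ ; root-pres = refl ; P-pres = λ _ _ → ⇔.sym isParent⇔ }

  tree≅unfolded : treeStructure tree ≅ unfolded
  tree≅unfolded = record { bijection = ↔-id _ ; root-pres = refl ; P-pres = λ _ _ → isParent⇔ }

  models : ∀ {φ} → IsΠ α φ → treeStructure T ⊨ φ → treeStructure tree ⊨ φ
  models {φ} isΠ sat = to (IsomorphismInvariance.sat-iso unfolded≅tree φ [])
    (BackAndForth.Preservation.preservesΠ (osuc α) em (treeStructure-rooted T) rooted isΠ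
      (record { embed = just ; mono = [_] ; bounds = [_]<⊤⁺ })
      (record { left = stop ; right = stop ; legalˡ = tt ; legalʳ = tt ; paired = [] })
      below-unfolded sat)

  scottSentence : HasΠScottSentence (α +ₒ 3) (treeStructure tree)
  scottSentence = HasΠScottSentence-≅ unfolded≅tree tree≅unfolded
    (ScottSentence.hasScottSentence em (osuc α) unfolded rooted (Tree.countable T) label colour colour-definable colour-spec
      (λ d → homogeneous (colour d) (colour-spec d)))

theorem1p2 : Classical →
    (α : Ordinal) (φ : Sentence) → IsΠ α φ →
    (Σ[ T ∈ Tree ] treeStructure T ⊨ φ) →
    Σ[ A ∈ Tree ]
    ( treeStructure A ⊨ φ
    × HasΠScottSentence (α +ₒ 3) (treeStructure A)
    × ScottRankAtMost (α +ₒ 2) (treeStructure A) )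
theorem1p2 em α φ isΠ (T , sat) =
  tree , models isΠ sat , scottSentence , ScottRank.scottRankAtMost em (treeStructure tree) (α +ₒ 2) scottSentence
  where open Model em α T
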